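{- Every integer $n > 4$ may be written as $n = p_1 + p_2 + \eta$, where $p_1, p_2$ are primes (not necessarily distinct) and $\eta$ is a square-free number.
   Context: A square-free number is a positive integer not divisible by the square of any prime; in particular $1$ is square-free. -}

module Defs where

open import Data.Nat using (ℕ; _*_; _<_)
open import Data.Nat.Divisibility using (_∤_)
open import Data.Nat.Primality using (Prime)

record SquareFree (n : ℕ) : Set where
  field
    positive : 0 < n
    p²∤n     : ∀ p → Prime p → p * p ∤ n

{-# OPTIONS --safe #-}

-- Let P be the set of the 2000 primes up to b = 17389, and let 4^k + b < n ≤ 4^(k+1) + b.
-- Suppose that for all p ∈ P and all primes r in (4^(k-3), 4^k] some prime square q² divides
-- n - p - r; charge the weight r to q whenever this happens. Multiplied over all pairs, the
-- charges amount to at least W^2000, where W is the product of the primes r, and W is about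
-- 2^(4^k) by Chebyshev's argument. For q ≤ 512, counting the members of P in the residue
-- classes modulo q² bounds the charges by W^1700. For q > 512 and fixed p, the primes r lie in
-- one class modulo q², that is, among N ≈ 4^k/q² terms of a progression; dividing the product of
-- these terms by the part of N! prime to q shows that the product of the r is at most q^(3N).
-- Since Σ 3 log₂(q)/q² over q > 512 is small, this is a contradiction once k ≥ 11.
-- For medium n, the case p = 2, r ∈ P and a plain count of the q suffice.
module Submission where

open import Defs
open import Data.Bool using (Bool; true; false; _∧_; _∨_; not; T; if_then_else_)
open import Data.Bool.Properties using (T?)
open import Data.Empty using (⊥-elim)
open import Data.List using (List; []; _∷_; _++_; applyUpTo; downFrom; filter; length; map)
open import Data.List.Membership.Propositional using (_∈_; _∉_; find)
open import Data.List.Membership.Propositional.Properties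
  using (∈-applyUpTo⁺; ∈-applyUpTo⁻; ∈-downFrom⁺; ∈-downFrom⁻; ∈-filter⁺; ∈-filter⁻; ∈-map⁺; ∈-++⁺ˡ; ∈-++⁺ʳ)
open import Data.List.Properties using (length-applyUpTo; length-filter; map-++; map-id)
open import Data.List.Relation.Unary.All as All using (All; []; _∷_; all?)
open import Data.List.Relation.Unary.All.Properties using (all-filter)
open import Data.List.Relation.Unary.AllPairs using ([]; _∷_)
open import Data.List.Relation.Unary.Any as Any using (Any; here; there; any?)
open import Data.List.Relation.Unary.Any.Properties using (++⁻)
open import Data.List.Relation.Unary.Unique.Propositional using (Unique)
import Data.List.Relation.Unary.Unique.Propositional.Properties as Unique
open import Data.Nat
open import Data.Nat.Combinatorics using (k![n∸k]!∣n!)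
open import Data.Nat.Coprimality as Coprimality using (Coprime; coprime-divisor; coprime-Bézout)
open import Data.Nat.Divisibility
open import Data.Nat.DivMod
open import Data.Nat.GCD using (module Bézout)
open import Data.Nat.Induction using (<-rec)
open import Data.Nat.ListAction using (product; sum)
open import Data.Nat.ListAction.Properties using (product-++; ∈⇒∣product; ∈⇒≤product)
open import Data.Nat.Primality
open import Data.Nat.Primality.Factorisation
  using (PrimeFactorisation; factorise; factorisationHasAllPrimeFactors)
open import Data.Nat.Properties
open import Data.Nat.Tactic.RingSolver using (solve-∀)
open import Data.Product using (_×_; _,_; proj₁; proj₂; ∃-syntax)
open import Data.Sum as Sum using (_⊎_; inj₁; inj₂; [_,_]′)
open import Data.Unit using (tt)
open import Function using (_∘_; id)
open import Level using (0ℓ)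
open import Relation.Binary.PropositionalEquality
open import Relation.Nullary using (Dec; yes; no; does; ¬_; ¬?; _×-dec_; contradiction)
open import Relation.Unary using (Pred; Decidable)

private
  variable
    k m n p : ℕ
    ps : List ℕ

-- Coprimality and divisibility by products of distinct primes.

prime∤⇒coprime : Prime p → p ∤ m → Coprime p m
prime∤⇒coprime p-prime p∤m (i∣p , i∣m) with prime⇒irreducible p-prime i∣p
... | inj₁ i≡1  = i≡1
... | inj₂ refl = contradiction i∣m p∤m

coprime-* : ∀ {a b c} → Coprime a c → Coprime b c → Coprime (a * b) c
coprime-* {a} {b} {c} a⊥c b⊥c {i} (i∣ab , i∣c) = b⊥c (coprime-divisor i⊥a i∣ab , i∣c)
  where
  i⊥a : Coprime i a
  i⊥a (j∣i , j∣a) = a⊥c (j∣a , ∣-trans j∣i i∣c)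

coprime⇒*-∣ : Coprime m n → m ∣ k → n ∣ k → m * n ∣ k
coprime⇒*-∣ {m} {n} m⊥n (divides-refl t) n∣tm =
  subst (m * n ∣_) (*-comm m t)
    (*-monoʳ-∣ m (coprime-divisor (Coprimality.sym m⊥n) (subst (n ∣_) (*-comm t m) n∣tm)))

prime∤! : Prime p → n < p → p ∤ n !
prime∤! {n = zero}  p-prime n<p p∣1 = contradiction (subst Prime (∣1⇒≡1 p∣1) p-prime) ¬prime[1]
prime∤! {n = suc n} p-prime n<p p∣n! with euclidsLemma (suc n) (n !) p-prime p∣n!
... | inj₁ p∣1+n = contradiction (∣⇒≤ p∣1+n) (<⇒≱ n<p)
... | inj₂ p∣n!′ = prime∤! p-prime (<-trans (n<1+n n) n<p) p∣n!′

prime-∤-product : All Prime ps → All (p ≢_) ps → Prime p → p ∤ product ps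
prime-∤-product ps-prime p∉ps p-prime p∣ =
  All.lookup p∉ps (factorisationHasAllPrimeFactors p-prime p∣ ps-prime) refl

-- Each `p` divides neither `m` nor the product of the other primes, so it is coprime to what has
-- been collected and can be multiplied in. Both upper bounds for products of primes rest on this.
distinct-primes-∣ : Unique ps → All Prime ps → All (_∤ m) ps → All (_∣ n) ps →
                    m ∣ n → m * product ps ∣ n
distinct-primes-∣ {[]} {m} {n} _ _ _ _ m∣n = subst (_∣ n) (sym (*-identityʳ m)) m∣n
distinct-primes-∣ {p ∷ ps} {m} {n} (p∉ps ∷ u) (p-prime ∷ ps-prime) (p∤m ∷ ps∤m) (p∣n ∷ ps∣n) m∣n =
  subst (_∣ n) (x∙yz≡y∙xz p m (product ps))
    (coprime⇒*-∣ (prime∤⇒coprime p-prime p∤) p∣n (distinct-primes-∣ u ps-prime ps∤m ps∣n m∣n))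
  where
  x∙yz≡y∙xz : ∀ x y z → x * (y * z) ≡ y * (x * z)
  x∙yz≡y∙xz = solve-∀
  p∤ : p ∤ m * product ps
  p∤ = [ p∤m , prime-∤-product ps-prime p∉ps p-prime ]′ ∘ euclidsLemma m (product ps) p-prime

-- Primes in intervals and Chebyshev's upper bound for the primorial.

opaque
  -- The interval (a, b]: with the left end excluded, dyadic intervals join without overlap.
  range : ℕ → ℕ → List ℕ
  range a b = applyUpTo (λ i → suc (a + i)) (b ∸ a)

  primes : ℕ → ℕ → List ℕ
  primes a b = filter prime? (range a b)

  ∈-primes⁺ : ∀ {a b} → Prime p → a < p → p ≤ b → p ∈ primes a b
  ∈-primes⁺ {a = a} {b} p-prime a<p p≤b with m≤n⇒∃[o]m+o≡n a<p
  ... | i , refl = ∈-filter⁺ prime? (∈-applyUpTo⁺ (λ j → suc (a + j)) i<b∸a) p-prime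
    where
    i<b∸a : i < b ∸ a
    i<b∸a = m+n≤o⇒m≤o∸n (suc i) (subst (λ x → suc x ≤ b) (+-comm a i) p≤b)

  ∈-primes⁻ : ∀ {a b} → p ∈ primes a b → Prime p × a < p × p ≤ b
  ∈-primes⁻ {a = a} {b} p∈ with ∈-filter⁻ prime? {xs = range a b} p∈
  ... | p∈range , p-prime with ∈-applyUpTo⁻ (λ j → suc (a + j)) {n = b ∸ a} p∈range
  ...   | i , i<b∸a , refl = p-prime , s≤s (m≤m+n a i) , (begin
    suc (a + i)  ≡⟨ +-suc a i ⟨
    a + suc i    ≤⟨ +-monoʳ-≤ a i<b∸a ⟩
    a + (b ∸ a)  ≡⟨ m+[n∸m]≡n (<⇒≤ a<b) ⟩
    b            ∎)
    where
    open ≤-Reasoning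
    a<b : a < b
    a<b with a <? b
    ... | yes a<b = a<b
    ... | no  a≮b = contradiction (subst (i <_) (m≤n⇒m∸n≡0 (≮⇒≥ a≮b)) i<b∸a) λ ()

  primes-unique : ∀ a b → Unique (primes a b)
  primes-unique a b = Unique.filter⁺ prime?
    (Unique.applyUpTo⁺₁ _ (b ∸ a) λ i<j _ → <⇒≢ (s≤s (+-monoʳ-< a i<j)))

  primes-prime : ∀ a b → All Prime (primes a b)
  primes-prime a b = all-filter prime? (range a b)

  length-primes-≤ : ∀ a b → length (primes a b) ≤ b ∸ a
  length-primes-≤ a b = ≤-trans (length-filter prime? (range a b)) (≤-reflexive (length-applyUpTo (λ i → suc (a + i)) (b ∸ a)))

∈-primes⇒∣product : ∀ {a b} → Prime p → a < p → p ≤ b → p ∣ product (primes a b)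
∈-primes⇒∣product p-prime a<p p≤b = ∈⇒∣product (∈-primes⁺ p-prime a<p p≤b)

product-primes-∣ : ∀ a {b n} → (∀ {p} → Prime p → a < p → p ≤ b → p ∤ m × p ∣ n) → m ∣ n →
                   m * product (primes a b) ∣ n
product-primes-∣ a {b} h = distinct-primes-∣ (primes-unique a b) (primes-prime a b)
  (All.tabulate λ p∈ → let p-prime , a<p , p≤b = ∈-primes⁻ p∈ in proj₁ (h p-prime a<p p≤b))
  (All.tabulate λ p∈ → let p-prime , a<p , p≤b = ∈-primes⁻ p∈ in proj₂ (h p-prime a<p p≤b))

-- The primorial, that is, the exponential of Chebyshev's function of this name.
θ : ℕ → ℕ
θ n = product (primes 0 n)

θ≢0 : ∀ n → NonZero (θ n)
θ≢0 n = productOfPrimes≢0 (primes-prime 0 n)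

prime>0 : Prime p → 0 < p
prime>0 {suc _} _ = s≤s z≤n

prime⇒≢1 : Prime p → p ≢ 1
prime⇒≢1 p-prime refl = ¬prime[1] p-prime

prime∤1 : Prime p → p ∤ 1
prime∤1 p-prime p∣1 = prime⇒≢1 p-prime (∣1⇒≡1 p∣1)

θ-∣ : ∀ a b → θ b ∣ θ a * product (primes a b)
θ-∣ a b = subst (_∣ θ a * product (primes a b)) (*-identityˡ (θ b))
  (product-primes-∣ 0 (λ p-prime _ p≤b → prime∤1 p-prime , p∣ p-prime p≤b) (1∣ _))
  where
  p∣ : Prime p → p ≤ b → p ∣ θ a * product (primes a b)
  p∣ {p} p-prime p≤b with p ≤? a
  ... | yes p≤a = ∣m⇒∣m*n _ (∈-primes⇒∣product p-prime (prime>0 p-prime) p≤a)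
  ... | no  p≰a = ∣n⇒∣m*n (θ a) (∈-primes⇒∣product p-prime (≰⇒> p≰a) p≤b)

θ-≤ : ∀ a b → θ b ≤ θ a * product (primes a b)
θ-≤ a b = ∣⇒≤ {{m*n≢0 _ _ {{θ≢0 a}} {{productOfPrimes≢0 (primes-prime a b)}}}} (θ-∣ a b)

[1+n+1+n]!≡ : ∀ n → (suc n + suc n) ! ≡ suc (suc (n + n)) * (suc (n + n) * (n + n) !)
[1+n+1+n]!≡ n = cong (_! ∘ suc) (+-suc n n)

[2+n+n]²*x*y²≡ : ∀ n x y → (2 + (n + n)) * ((2 + (n + n)) * (x * (y * y))) ≡ 4 * x * (suc n * y * (suc n * y))
[2+n+n]²*x*y²≡ = solve-∀

-- The central binomial coefficient is at most 4^n, with denominators cleared: from n to n + 1 it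
-- grows by the factor (2n + 2)(2n + 1)/(n + 1)^2, which is less than 4.
[n+n]!≤4^n*n!*n! : ∀ n → (n + n) ! ≤ 4 ^ n * (n ! * n !)
[n+n]!≤4^n*n!*n! zero    = ≤-refl
[n+n]!≤4^n*n!*n! (suc n) = begin
  (suc n + suc n) !                                        ≡⟨ [1+n+1+n]!≡ n ⟩
  suc (suc (n + n)) * (suc (n + n) * (n + n) !)            ≤⟨ *-monoʳ-≤ (2 + (n + n)) (*-mono-≤ (n≤1+n (suc (n + n))) ([n+n]!≤4^n*n!*n! n)) ⟩
  (2 + (n + n)) * ((2 + (n + n)) * (4 ^ n * (n ! * n !)))  ≡⟨ [2+n+n]²*x*y²≡ n (4 ^ n) (n !) ⟩
  4 ^ suc n * (suc n ! * suc n !)                          ∎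
  where open ≤-Reasoning

-- In the induction step the left side gains (2n + 2)^2, the right side (2n + 3)(2n + 2).
4^n*n!*n!≤[1+n+n]! : ∀ n → 4 ^ n * (n ! * n !) ≤ suc (n + n) !
4^n*n!*n!≤[1+n+n]! zero    = ≤-refl
4^n*n!*n!≤[1+n+n]! (suc n) = begin
  4 ^ suc n * (suc n ! * suc n !)                                    ≡⟨ [2+n+n]²*x*y²≡ n (4 ^ n) (n !) ⟨
  (2 + (n + n)) * ((2 + (n + n)) * (4 ^ n * (n ! * n !)))            ≤⟨ *-mono-≤ (n≤1+n (2 + (n + n))) (*-monoʳ-≤ (2 + (n + n)) (4^n*n!*n!≤[1+n+n]! n)) ⟩
  (3 + (n + n)) * ((2 + (n + n)) * (suc (n + n) * (n + n) !))        ≡⟨ cong (_! ∘ suc ∘ suc) (+-suc n n) ⟨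
  suc (suc n + suc n) !                                              ∎
  where open ≤-Reasoning

-- Every prime in (n, 2n] divides (2n)! but not n! n!, hence divides the central binomial
-- coefficient.
product-primes[n,n+n]≤4^n : ∀ n → product (primes n (n + n)) ≤ 4 ^ n
product-primes[n,n+n]≤4^n n = *-cancelˡ-≤ (n ! * n !) {{nz}} (begin
  n ! * n ! * product (primes n (n + n))  ≤⟨ ∣⇒≤ {{(n + n) !≢0}} (product-primes-∣ n (λ pp n<p p≤2n → p∤ pp n<p , p∣ pp p≤2n) n!n!∣) ⟩
  (n + n) !                               ≤⟨ [n+n]!≤4^n*n!*n! n ⟩
  4 ^ n * (n ! * n !)                     ≡⟨ *-comm (4 ^ n) _ ⟩
  n ! * n ! * 4 ^ n                       ∎)
  where
  open ≤-Reasoning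
  nz : NonZero (n ! * n !)
  nz = n !* n !≢0
  n!n!∣ : n ! * n ! ∣ (n + n) !
  n!n!∣ = subst (λ x → n ! * x ! ∣ (n + n) !) (m+n∸n≡m n n) (k![n∸k]!∣n! (m≤m+n n n))
  p∤ : Prime p → n < p → p ∤ n ! * n !
  p∤ p-prime n<p = [ prime∤! p-prime n<p , prime∤! p-prime n<p ]′ ∘ euclidsLemma _ _ p-prime
  p∣ : Prime p → p ≤ n + n → p ∣ (n + n) !
  p∣ {suc p} _ p≤2n = ∣-trans (m∣m*n (p !)) (m≤n⇒m!∣n! p≤2n)

-- Doubling 2^k costs at most a factor 4^(2^k), which squares the bound.
θ[2^k]≤4^2^k : ∀ k → θ (2 ^ k) ≤ 4 ^ (2 ^ k)
θ[2^k]≤4^2^k zero    = begin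
  θ 1      ≡⟨ *-identityˡ (θ 1) ⟨
  1 * θ 1  ≤⟨ ∣⇒≤ (product-primes-∣ 0 (λ p-prime 0<p p≤1 → contradiction (≤-antisym p≤1 0<p) (prime⇒≢1 p-prime)) (1∣ 1)) ⟩
  1        ≤⟨ s≤s z≤n ⟩
  4        ∎
  where open ≤-Reasoning
θ[2^k]≤4^2^k (suc k) = begin
  θ (2 ^ suc k)                               ≡⟨ cong θ 2x≡x+x ⟩
  θ (x + x)                                   ≤⟨ θ-≤ x (x + x) ⟩
  θ x * product (primes x (x + x))            ≤⟨ *-mono-≤ (θ[2^k]≤4^2^k k) (product-primes[n,n+n]≤4^n x) ⟩
  4 ^ x * 4 ^ x                               ≡⟨ ^-distribˡ-+-* 4 x x ⟨
  4 ^ (x + x)                                 ≡⟨ cong (4 ^_) 2x≡x+x ⟨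
  4 ^ (2 ^ suc k)                             ∎
  where
  open ≤-Reasoning
  x = 2 ^ k
  2x≡x+x : 2 ^ suc k ≡ x + x
  2x≡x+x = cong (x +_) (+-identityʳ x)

-- A lower bound for products of primes

-- The divisibility form of the recursion of the Leibniz harmonic triangle: the two
-- multiples of (k + m + 2)! in the induction step add up to (k + m + 2) · D · k! · m!.
leibniz-∣ : ∀ k m {D} → (∀ {j} → 0 < j → j ≤ suc (k + m) → j ∣ D) →
            suc (k + m) ! ∣ D * (k ! * m !)
leibniz-∣ zero    m {D} h = subst (suc m ! ∣_) (cong (D *_) (sym (*-identityˡ (m !))))
  (*-monoˡ-∣ (m !) (h (s≤s z≤n) ≤-refl))
leibniz-∣ (suc k) m {D} h = ∣m+n∣m⇒∣n (subst (suc (suc k + m) ! ∣_) (sym (split k m D (k !) (m !))) whole) part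
  where
  split : ∀ k m D x y → D * (x * (suc m * y)) + D * (suc k * x * y) ≡ suc (suc (k + m)) * (D * (x * y))
  split = solve-∀
  whole : suc (suc k + m) ! ∣ suc (suc (k + m)) * (D * (k ! * m !))
  whole = *-monoʳ-∣ (suc (suc (k + m))) (leibniz-∣ k m λ 0<j j≤ → h 0<j (m≤n⇒m≤1+n j≤))
  part : suc (suc k + m) ! ∣ D * (k ! * suc m !)
  part = subst (λ i → suc i ! ∣ D * (k ! * suc m !)) (+-suc k m)
    (leibniz-∣ k (suc m) λ {j} 0<j j≤ → h 0<j (subst (λ i → j ≤ suc i) (+-suc k m) j≤))

-- Nair's lower bound for common multiples: by `leibniz-∣` at k = m = g, (2g + 1)! divides D g! g!,
-- while (2g + 1)! is at least 4^g g! g!.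
common-multiple-≥ : ∀ g {D} → .{{NonZero D}} → (∀ {j} → 0 < j → j ≤ suc (g + g) → j ∣ D) → 4 ^ g ≤ D
common-multiple-≥ g {D} h = *-cancelʳ-≤ (4 ^ g) D (g ! * g !) {{g !* g !≢0}} (begin
  4 ^ g * (g ! * g !)  ≤⟨ 4^n*n!*n!≤[1+n+n]! g ⟩
  suc (g + g) !        ≤⟨ ∣⇒≤ {{m*n≢0 D (g ! * g !)}} (leibniz-∣ g g h) ⟩
  D * (g ! * g !)      ∎)
  where
  open ≤-Reasoning
  instance _ = g !* g !≢0

m^n∣m^o : ∀ m {n o} → n ≤ o → m ^ n ∣ m ^ o
m^n∣m^o m {n} n≤o with m≤n⇒∃[o]m+o≡n n≤o
... | i , refl = subst (m ^ n ∣_) (sym (^-distribˡ-+-* m n i)) (m∣m*n (m ^ i))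

2^-cancel-≤ : 2 ^ m ≤ 2 ^ n → m ≤ n
2^-cancel-≤ {m} {n} 2^m≤2^n with m ≤? n
... | yes m≤n = m≤n
... | no  m≰n = contradiction 2^m≤2^n (<⇒≱ (^-monoʳ-< 2 (s≤s (s≤s z≤n)) (≰⇒> m≰n)))

prime⇒2≤ : Prime p → 2 ≤ p
prime⇒2≤ p-prime = nonTrivial⇒n>1 _ {{prime⇒nonTrivial p-prime}}

2^length≤product : All Prime ps → 2 ^ length ps ≤ product ps
2^length≤product []                   = ≤-refl
2^length≤product (p-prime ∷ ps-prime) = *-mono-≤ (prime⇒2≤ p-prime) (2^length≤product ps-prime)

product-∣-θ^ : ∀ {y} → All Prime ps → All (_≤ y) ps → product ps ∣ θ y ^ length ps
product-∣-θ^ []                   []             = ∣-refl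
product-∣-θ^ (p-prime ∷ ps-prime) (p≤y ∷ ps≤y) =
  *-pres-∣ (∈-primes⇒∣product p-prime (prime>0 p-prime) p≤y) (product-∣-θ^ ps-prime ps≤y)

-- At most one prime factor of a number up to y² exceeds y.
product-∣-θ^*θ : ∀ {y} → All Prime ps → product ps ≤ y * y → product ps ∣ θ y ^ length ps * θ (y * y)
product-∣-θ^*θ                  []                   _  = 1∣ _
product-∣-θ^*θ {p ∷ ps} {y} (p-prime ∷ ps-prime) p*ps≤y² with p ≤? y
... | yes p≤y = subst (p * product ps ∣_) (sym (*-assoc (θ y) (θ y ^ length ps) (θ (y * y))))
  (*-pres-∣ (∈-primes⇒∣product p-prime (prime>0 p-prime) p≤y)
            (product-∣-θ^*θ ps-prime (≤-trans (m≤n*m (product ps) p {{prime⇒nonZero p-prime}}) p*ps≤y²)))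
... | no  p≰y = subst (p * product ps ∣_) (*-comm (θ (y * y)) _)
  (*-pres-∣ (∈-primes⇒∣product p-prime (prime>0 p-prime) (≤-trans (m≤m*n p (product ps) {{productOfPrimes≢0 ps-prime}}) p*ps≤y²))
            (∣n⇒∣m*n (θ y) (product-∣-θ^ ps-prime (All.tabulate λ q∈ → ≤-trans (∈⇒≤product (All.map prime⇒nonZero ps-prime) q∈) ps≤y))))
  where
  ps≤y : product ps ≤ y
  ps≤y with product ps ≤? y
  ... | yes ps≤y = ps≤y
  ... | no  ps≰y = contradiction p*ps≤y² (<⇒≱ (*-mono-< (≰⇒> p≰y) (≰⇒> ps≰y)))

-- A number up to 4^k has at most 2k prime factors, and at most one of them exceeds 2^k. So this is
-- a common multiple of all numbers up to 4^k, with θ(4^k) as its main factor.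
j∣θ^*θ : ∀ k {j} → 0 < j → j ≤ 2 ^ k * 2 ^ k → j ∣ θ (2 ^ k) ^ (k + k) * θ (2 ^ k * 2 ^ k)
j∣θ^*θ k {j} 0<j j≤ = ∣-trans j∣ (*-monoˡ-∣ (θ (2 ^ k * 2 ^ k)) (m^n∣m^o (θ (2 ^ k)) length≤))
  where
  open PrimeFactorisation (factorise j {{>-nonZero 0<j}})
    using (isFactorisation; factorsPrime) renaming (factors to qs)
  qs≤ : product qs ≤ 2 ^ k * 2 ^ k
  qs≤ = subst (_≤ 2 ^ k * 2 ^ k) isFactorisation j≤
  j∣ : j ∣ θ (2 ^ k) ^ length qs * θ (2 ^ k * 2 ^ k)
  j∣ = subst (_∣ θ (2 ^ k) ^ length qs * θ (2 ^ k * 2 ^ k)) (sym isFactorisation) (product-∣-θ^*θ factorsPrime qs≤)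
  length≤ : length qs ≤ k + k
  length≤ = 2^-cancel-≤ (≤-trans (2^length≤product factorsPrime)
              (≤-trans qs≤ (≤-reflexive (sym (^-distribˡ-+-* 2 k k)))))

4^n≡2^[n+n] : ∀ n → 4 ^ n ≡ 2 ^ (n + n)
4^n≡2^[n+n] n = trans (^-*-assoc 2 2 n) (cong (2 ^_) (cong (n +_) (+-identityʳ n)))

-- With x = 2g + 2, the common multiple θ(2^k)^(2k) θ(x) is at least 4^g. The upper bound for θ
-- limits the share of θ(2^k) and of the primes up to 2^c; the remaining primes must account for the
-- rest. The summand 2 in the exponent pays for x - 2g.
product-primes-≥ : ∀ k c → .{{NonZero k}} → let x = 2 ^ k * 2 ^ k in
                   2 ^ x ≤ 2 ^ (2 + (2 ^ k * (k + k) + 2 ^ c) * 2) * product (primes (2 ^ c) x)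
product-primes-≥ (suc k) c = begin
  2 ^ x                                                       ≡⟨ trans (cong (2 ^_) x≡2+g+g) (^-distribˡ-+-* 2 2 (g + g)) ⟩
  4 * 2 ^ (g + g)                                             ≡⟨ cong (4 *_) (4^n≡2^[n+n] g) ⟨
  4 * 4 ^ g                                                   ≤⟨ *-monoʳ-≤ 4 (common-multiple-≥ g {{m*n≢0 (θ y ^ (suc k + suc k)) (θ x) {{m^n≢0 (θ y) (suc k + suc k) {{θ≢0 y}}}} {{θ≢0 x}}}} λ 0<j j≤ → j∣θ^*θ (suc k) 0<j (≤-trans j≤ g+g<x)) ⟩
  4 * (θ y ^ (suc k + suc k) * θ x)                           ≤⟨ *-monoʳ-≤ 4 (*-mono-≤ (^-monoˡ-≤ (suc k + suc k) (θ[2^k]≤4^2^k (suc k))) (≤-trans (θ-≤ (2 ^ c) x) (*-monoˡ-≤ W (θ[2^k]≤4^2^k c)))) ⟩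
  4 * ((4 ^ y) ^ (suc k + suc k) * (4 ^ (2 ^ c) * W))         ≡⟨ cong (λ z → 4 * (z * (4 ^ (2 ^ c) * W))) (^-*-assoc 4 y (suc k + suc k)) ⟩
  4 * (4 ^ (y * (suc k + suc k)) * (4 ^ (2 ^ c) * W))         ≡⟨ cong (4 *_) (*-assoc (4 ^ (y * (suc k + suc k))) _ W) ⟨
  4 * (4 ^ (y * (suc k + suc k)) * 4 ^ (2 ^ c) * W)           ≡⟨ cong (λ z → 4 * (z * W)) (^-distribˡ-+-* 4 (y * (suc k + suc k)) (2 ^ c)) ⟨
  4 * (4 ^ e * W)                                             ≡⟨ *-assoc 4 (4 ^ e) W ⟨
  4 * 4 ^ e * W                                               ≡⟨ cong (λ z → 4 * z * W) (trans (^-*-assoc 2 2 e) (cong (2 ^_) (*-comm 2 e))) ⟩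
  4 * 2 ^ (e * 2) * W                                         ≡⟨ cong (_* W) (^-distribˡ-+-* 2 2 (e * 2)) ⟨
  2 ^ (2 + e * 2) * W                                         ∎
  where
  open ≤-Reasoning
  y = 2 ^ suc k
  x = y * y
  W = product (primes (2 ^ c) x)
  e = y * (suc k + suc k) + 2 ^ c
  h = 2 ^ k * y
  g = pred h
  h≡1+g : h ≡ suc g
  h≡1+g = sym (suc-pred h {{m*n≢0 (2 ^ k) y {{m^n≢0 2 k}} {{m^n≢0 2 (suc k)}}}})
  x≡h+h : x ≡ h + h
  x≡h+h = trans (*-assoc 2 (2 ^ k) y) (cong (h +_) (+-identityʳ h))
  x≡2+g+g : x ≡ 2 + (g + g)
  x≡2+g+g = trans x≡h+h (trans (cong₂ _+_ h≡1+g h≡1+g) (cong suc (+-suc g g)))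
  g+g<x : suc (g + g) ≤ x
  g+g<x = ≤-trans (n≤1+n _) (≤-reflexive (sym x≡2+g+g))

-- Primes in residue classes modulo q²

-- The product a (a + d) ... (a + (N - 1) d), a rising factorial with step d.
progression : ℕ → ℕ → ℕ → ℕ
progression a d zero    = 1
progression a d (suc N) = (a + N * d) * progression a d N

term-∣-progression : ∀ a d {N} → k < N → a + k * d ∣ progression a d N
term-∣-progression {k} a d {suc N} k<1+N with m<1+n⇒m<n∨m≡n k<1+N
... | inj₁ k<N  = ∣n⇒∣m*n (a + N * d) (term-∣-progression a d k<N)
... | inj₂ refl = m∣m*n (progression a d N)

progression≢0 : ∀ a d N → .{{NonZero a}} → NonZero (progression a d N)
progression≢0 a d zero    = _
progression≢0 (suc a) d (suc N) = m*n≢0 (suc a + N * d) _ {{_}} {{progression≢0 (suc a) d N}}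

-- Factor by factor, the terms are compared with d, 2d, ..., N d.
progression-≤ : ∀ {a d} N → a ≤ d → progression a d N ≤ d ^ N * N !
progression-≤ zero                a≤d = ≤-refl
progression-≤ {a} {d} (suc N) a≤d = begin
  (a + N * d) * progression a d N  ≤⟨ *-mono-≤ (+-monoˡ-≤ (N * d) a≤d) (progression-≤ N a≤d) ⟩
  suc N * d * (d ^ N * N !)        ≡⟨ regroup N d (d ^ N) (N !) ⟩
  d ^ suc N * suc N !              ∎
  where
  open ≤-Reasoning
  regroup : ∀ N d x y → suc N * d * (x * y) ≡ d * x * (suc N * y)
  regroup = solve-∀

-- Modulo m the product depends only on the class of its first term. The multiple of m is exhibited,
-- so that no subtraction occurs.
progression-shift : ∀ a d m t N → ∃[ s ] progression (a + m * t) d N ≡ progression a d N + m * s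
progression-shift a d m t zero    = 0 , cong suc (sym (*-zeroʳ m))
progression-shift a d m t (suc N) with progression-shift a d m t N
... | s , eq = t * X + (a + m * t + N * d) * s ,
               trans (cong ((a + m * t + N * d) *_) eq) (expand a m t (N * d) X s)
  where
  X = progression a d N
  expand : ∀ a m t z X s → (a + m * t + z) * (X + m * s) ≡ (a + z) * X + m * (t * X + (a + m * t + z) * s)
  expand = solve-∀

progression-scale : ∀ b d N → progression (d * b) d N ≡ d ^ N * progression b 1 N
progression-scale b d zero    = refl
progression-scale b d (suc N) = trans (cong ((d * b + N * d) *_) (progression-scale b d N))
  (regroup b d N (d ^ N) (progression b 1 N))
  where
  regroup : ∀ b d N x y → (d * b + N * d) * (x * y) ≡ d * x * ((b + N * 1) * y)
  regroup = solve-∀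

progression*! : ∀ c N → progression (suc c) 1 N * c ! ≡ (c + N) !
progression*! c zero    = trans (*-identityˡ (c !)) (cong _! (sym (+-identityʳ c)))
progression*! c (suc N) = begin
  (suc c + N * 1) * progression (suc c) 1 N * c !    ≡⟨ *-assoc (suc c + N * 1) (progression (suc c) 1 N) (c !) ⟩
  (suc c + N * 1) * (progression (suc c) 1 N * c !)  ≡⟨ cong₂ _*_ (cong (suc c +_) (*-identityʳ N)) (progression*! c N) ⟩
  suc (c + N) * (c + N) !                            ≡⟨ cong _! (+-suc c N) ⟨
  (c + suc N) !                                      ∎
  where open ≡-Reasoning

-- The quotient is the binomial coefficient of c + N over N.
!-∣-progression : ∀ c N → N ! ∣ progression (suc c) 1 N
!-∣-progression c N = *-cancelʳ-∣ (c !) {{c !≢0}} (subst₂ _∣_ (*-comm (c !) (N !)) (sym (progression*! c N))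
  (subst (λ i → c ! * i ! ∣ (c + N) !) (m+n∸m≡n c N) (k![n∸k]!∣n! (m≤m+n c N))))

-- Bézout's identity yields an inverse of d modulo m, up to sign; b is a times this inverse.
solve-≡-mod : ∀ a d → .{{NonZero d}} → Coprime m d → ∃[ b ] ∃[ t ] d * b ≡ a + m * t
solve-≡-mod {m} a d@(suc d-1) m⊥d with coprime-Bézout m⊥d
... | Bézout.-+ x y 1+xm≡yd = y * a , x * a , (begin
  d * (y * a)       ≡⟨ lhs d y a ⟩
  y * d * a         ≡⟨ cong (_* a) 1+xm≡yd ⟨
  (1 + x * m) * a   ≡⟨ rhs x m a ⟩
  a + m * (x * a)   ∎)
  where
  open ≡-Reasoning
  lhs : ∀ d y a → d * (y * a) ≡ y * d * a
  lhs = solve-∀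
  rhs : ∀ x m a → (1 + x * m) * a ≡ a + m * (x * a)
  rhs = solve-∀
-- Here m = 1, so b = a will do.
... | Bézout.+- x zero 1≡xm rewrite m*n≡1⇒n≡1 x m (sym 1≡xm) = a , d-1 * a , cong (a +_) (sym (*-identityˡ (d-1 * a)))
-- Here y d ≡ −1 (mod m), so y² d inverts d.
... | Bézout.+- x (suc y) 1+yd≡xm = suc y * suc y * d * a , v * x * a , (begin
  d * (suc y * suc y * d * a)         ≡⟨ lhs y d-1 a ⟩
  (1 + v * (1 + suc y * d)) * a       ≡⟨ cong (λ z → (1 + v * z) * a) 1+yd≡xm ⟩
  (1 + v * (x * m)) * a               ≡⟨ rhs v x m a ⟩
  a + m * (v * x * a)                 ∎)
  where
  open ≡-Reasoning
  -- This is `suc y * d` minus 1, so the square of `suc y * d` is 1 + v (1 + `suc y * d`).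
  v = d-1 + y * d
  lhs : ∀ y d a → suc d * (suc y * suc y * suc d * a) ≡ (1 + (d + y * suc d) * (1 + suc y * suc d)) * a
  lhs = solve-∀
  rhs : ∀ v x m a → (1 + v * (x * m)) * a ≡ a + m * (v * x * a)
  rhs = solve-∀

-- Since d is invertible modulo m, the progression is congruent to d^N times a product of N
-- consecutive integers, which N! divides.
coprime-∣!⇒∣progression : ∀ a d N → .{{NonZero d}} → .{{NonZero m}} → Coprime m d → m ∣ N ! →
                          m ∣ progression a d N
coprime-∣!⇒∣progression {m@(suc m-1)} a d N m⊥d m∣N! with solve-≡-mod a d m⊥d
... | b , t , db≡a+mt with progression-shift a d m (t + d) N
...   | s , eq = ∣m+n∣m⇒∣n (subst (m ∣_) (trans (cong (λ z → progression z d N) shifted) (trans eq (+-comm _ (m * s)))) m∣) (m∣m*n s)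
  where
  -- Adding m to b makes the first term a successor, as `!-∣-progression` demands.
  shifted : d * (m + b) ≡ a + m * (t + d)
  shifted = trans (*-distribˡ-+ d m b) (trans (cong (d * m +_) db≡a+mt) (regroup a d m t))
    where
    regroup : ∀ a d m t → d * m + (a + m * t) ≡ a + m * (t + d)
    regroup = solve-∀
  m∣ : m ∣ progression (d * (m + b)) d N
  m∣ = subst (m ∣_) (sym (progression-scale (m + b) d N))
         (∣n⇒∣m*n (d ^ N) (∣-trans m∣N! (!-∣-progression (m-1 + b) N)))

-- Among 1, ..., N the M multiples of q contribute q^M M!; the other factors make up u.
!-≡-multiples : ∀ {q} → Prime q → ∀ N → ∃[ M ] ∃[ r ] ∃[ u ]
  (N ≡ r + M * q × r < q × N ! ≡ u * (q ^ M * M !) × Coprime u q)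
!-≡-multiples q-prime zero = 0 , 0 , 1 , refl , prime>0 q-prime , refl , Coprimality.1-coprimeTo _
!-≡-multiples {q} q-prime (suc N) with !-≡-multiples q-prime N
... | M , r , u , refl , r<q , N!≡ , u⊥q with suc r <? q
...   | yes 1+r<q = M , suc r , suc N * u , refl , 1+r<q ,
                    trans (cong (suc N *_) N!≡) (sym (*-assoc (suc N) u _)) ,
                    coprime-* (Coprimality.sym (prime∤⇒coprime q-prime q∤1+N)) u⊥q
  where
  q∤1+N : q ∤ suc r + M * q
  q∤1+N q∣ = contradiction (∣⇒≤ (∣m+n∣m⇒∣n (subst (q ∣_) (+-comm (suc r) (M * q)) q∣) (n∣m*n M))) (<⇒≱ 1+r<q)
...   | no 1+r≮q = suc M , 0 , u , cong (_+ M * q) 1+r≡q , prime>0 q-prime ,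
                   trans (cong₂ _*_ (cong (_+ M * q) 1+r≡q) N!≡) (regroup u q M (q ^ M) (M !)) , u⊥q
  where
  1+r≡q : suc r ≡ q
  1+r≡q = ≤-antisym r<q (≮⇒≥ 1+r≮q)
  regroup : ∀ u q M x y → (q + M * q) * (u * (x * y)) ≡ u * (q * x * (suc M * y))
  regroup = solve-∀

-- Legendre's count by descent: splitting off q^M leaves M!, whose q-part is at most q^M by
-- induction, and M + M is at most N because q is at least 2.
!-coprime-part : ∀ {q} → Prime q → ∀ N → ∃[ e ] ∃[ m ] (N ! ≡ e * m × Coprime m q × e ≤ q ^ N)
!-coprime-part {q} q-prime = <-rec _ step
  where
  step : ∀ N → (∀ {M} → M < N → ∃[ e ] ∃[ m ] (M ! ≡ e * m × Coprime m q × e ≤ q ^ M)) →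
         ∃[ e ] ∃[ m ] (N ! ≡ e * m × Coprime m q × e ≤ q ^ N)
  step zero        rec = 1 , 1 , refl , Coprimality.1-coprimeTo q , ≤-refl
  step N@(suc N-1) rec with !-≡-multiples q-prime N
  ... | M , r , u , N≡ , r<q , N!≡ , u⊥q = extend (rec (M<N M M+M≤N))
    where
    M+M≤N : M + M ≤ N
    M+M≤N = begin
      M + M      ≡⟨ cong (M +_) (+-identityʳ M) ⟨
      2 * M      ≤⟨ *-monoˡ-≤ M (prime⇒2≤ q-prime) ⟩
      q * M      ≡⟨ *-comm q M ⟩
      M * q      ≤⟨ m≤n+m (M * q) r ⟩
      r + M * q  ≡⟨ N≡ ⟨
      N          ∎
      where open ≤-Reasoning
    M<N : ∀ M → M + M ≤ N → M < N
    M<N zero    _     = s≤s z≤n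
    M<N (suc M) M+M≤N = <-≤-trans (m<m+n (suc M) (s≤s z≤n)) M+M≤N
    extend : ∃[ e ] ∃[ m ] (M ! ≡ e * m × Coprime m q × e ≤ q ^ M) →
             ∃[ e ] ∃[ m ] (N ! ≡ e * m × Coprime m q × e ≤ q ^ N)
    extend (e , m , M!≡ , m⊥q , e≤) = q ^ M * e , u * m , N!≡′ , coprime-* u⊥q m⊥q , (begin
      q ^ M * e      ≤⟨ *-monoʳ-≤ (q ^ M) e≤ ⟩
      q ^ M * q ^ M  ≡⟨ ^-distribˡ-+-* q M M ⟨
      q ^ (M + M)    ≤⟨ ^-monoʳ-≤ q {{prime⇒nonZero q-prime}} M+M≤N ⟩
      q ^ N          ∎)
      where
      open ≤-Reasoning
      regroup : ∀ u x e m → u * (x * (e * m)) ≡ x * e * (u * m)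
      regroup = solve-∀
      N!≡′ : N ! ≡ q ^ M * e * (u * m)
      N!≡′ = trans N!≡ (trans (cong (λ z → u * (q ^ M * z)) M!≡) (regroup u (q ^ M) e m))

^-distribʳ-* : ∀ N x y → (x * y) ^ N ≡ x ^ N * y ^ N
^-distribʳ-* zero    x y = refl
^-distribʳ-* (suc N) x y = trans (cong (x * y *_) (^-distribʳ-* N x y)) (swap x y (x ^ N) (y ^ N))
  where
  swap : ∀ x y a b → x * y * (a * b) ≡ x * a * (y * b)
  swap = solve-∀

-- A Brun–Titchmarsh bound à la Chebyshev: the product of the terms, divided by the part of
-- N! prime to q, is an integer that is still divisible by every prime term exceeding N.
product-primes-in-progression-≤ : ∀ {q a} N → Prime q → 0 < a → a ≤ q * q →
  Unique ps → All Prime ps → All (N <_) ps → All (_∣ progression a (q * q) N) ps →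
  product ps ≤ (q * q * q) ^ N
product-primes-in-progression-≤ {ps} {q} {a} N q-prime 0<a a≤q² u ps-prime N<ps ps∣ with !-coprime-part q-prime N
... | e , m , N!≡ , m⊥q , e≤ = *-cancelˡ-≤ m (begin
  m * product ps                  ≤⟨ ∣⇒≤ {{progression≢0 a (q * q) N}} m*ps∣ ⟩
  progression a (q * q) N         ≤⟨ progression-≤ N a≤q² ⟩
  (q * q) ^ N * N !               ≡⟨ cong ((q * q) ^ N *_) N!≡ ⟩
  (q * q) ^ N * (e * m)           ≤⟨ *-monoʳ-≤ ((q * q) ^ N) (*-monoˡ-≤ m e≤) ⟩
  (q * q) ^ N * (q ^ N * m)       ≡⟨ regroup ((q * q) ^ N) (q ^ N) m ⟩
  m * ((q * q) ^ N * q ^ N)       ≡⟨ cong (m *_) (^-distribʳ-* N (q * q) q) ⟨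
  m * (q * q * q) ^ N             ∎)
  where
  open ≤-Reasoning
  instance
    _ = >-nonZero 0<a
    _ = prime⇒nonZero q-prime
    _ = m*n≢0 q q
    m≢0 : NonZero m
    m≢0 = m*n≢0⇒n≢0 e {{subst NonZero N!≡ (N !≢0)}}
  regroup : ∀ x y m → x * (y * m) ≡ m * (x * y)
  regroup = solve-∀
  m∣N! : m ∣ N !
  m∣N! = subst (m ∣_) (sym N!≡) (n∣m*n e)
  m⊥q² : Coprime m (q * q)
  m⊥q² = Coprimality.sym (coprime-* (Coprimality.sym m⊥q) (Coprimality.sym m⊥q))
  m*ps∣ : m * product ps ∣ progression a (q * q) N
  m*ps∣ = distinct-primes-∣ u ps-prime
    (All.zipWith (λ (p-prime , N<p) p∣m → prime∤! p-prime N<p (∣-trans p∣m m∣N!)) (ps-prime , N<ps))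
    ps∣ (coprime-∣!⇒∣progression a (q * q) N m⊥q² m∣N!)

prime²∤prime : ∀ {q} → Prime q → Prime p → q * q ∤ p
prime²∤prime {p} {q} q-prime p-prime q²∣p with prime⇒irreducible p-prime (∣-trans (m∣m*n {q} q) q²∣p)
... | inj₁ refl = ¬prime[1] q-prime
... | inj₂ refl = contradiction (∣⇒≤ {{prime⇒nonZero p-prime}} q²∣p)
                    (<⇒≱ (m<m*n q q {{prime⇒nonZero p-prime}} (prime⇒2≤ p-prime)))

∣∸⇒%≡ : ∀ {d p c} → .{{_ : NonZero d}} → p ≤ c → d ∣ c ∸ p → p % d ≡ c % d
∣∸⇒%≡ {d} {p} p≤c d∣c∸p = trans (sym (%-remove-+ʳ p d∣c∸p)) (cong (_% d) (m+[n∸m]≡n p≤c))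

-- The primes in question lie in the class r of c modulo q². If r = 0, there are none, as q² divides
-- no prime. Otherwise b < N q² places them among the first N terms from r on, and N ≤ a makes them
-- exceed N.
product-primes-with-q²∣-≤ : ∀ {q a b c N} → Prime q → b < c → N ≤ a → b < N * (q * q) →
  product (filter (λ p → q * q ∣? (c ∸ p)) (primes a b)) ≤ (q * q * q) ^ N
product-primes-with-q²∣-≤ {q} {a} {b} {c} {N} q-prime b<c N≤a b<Nq² =
  bound (c % (q * q)) refl
  where
  instance
    _ = prime⇒nonZero q-prime
    _ = m*n≢0 q q
  P? = λ p → q * q ∣? (c ∸ p)
  terms = filter P? (primes a b)
  spec : ∀ {p} → p ∈ terms → q * q ∣ c ∸ p × Prime p × a < p × p ≤ b
  spec p∈ with ∈-filter⁻ P? {xs = primes a b} p∈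
  ... | p∈primes , q²∣ = q²∣ , ∈-primes⁻ p∈primes
  residue : ∀ {p} → q * q ∣ c ∸ p → p ≤ b → p % (q * q) ≡ c % (q * q)
  residue q²∣ p≤b = ∣∸⇒%≡ (<⇒≤ (≤-<-trans p≤b b<c)) q²∣
  bound : ∀ r → c % (q * q) ≡ r → product terms ≤ (q * q * q) ^ N
  bound zero c%≡0 = ≤-trans (≤-reflexive (cong product (none terms λ p∈ →
      let q²∣ , p-prime , _ , p≤b = spec p∈ in
      prime²∤prime q-prime p-prime (m%n≡0⇒n∣m _ _ (trans (residue q²∣ p≤b) c%≡0)))))
      (m^n>0 (q * q * q) {{m*n≢0 (q * q) q}} N)
    where
    none : ∀ (xs : List ℕ) → (∀ {x} → x ∉ xs) → xs ≡ []
    none []       _  = refl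
    none (x ∷ xs) x∉ = contradiction (here refl) x∉
  bound r@(suc _) c%≡r = product-primes-in-progression-≤ N q-prime (s≤s z≤n)
      (subst (_≤ q * q) c%≡r (<⇒≤ (m%n<n c (q * q))))
      (Unique.filter⁺ P? (primes-unique a b))
      (All.tabulate λ p∈ → proj₁ (proj₂ (spec p∈)))
      (All.tabulate λ p∈ → ≤-<-trans N≤a (proj₁ (proj₂ (proj₂ (spec p∈)))))
      (All.tabulate λ p∈ → let q²∣ , _ , _ , p≤b = spec p∈ in p∣ q²∣ p≤b)
    where
    p∣ : ∀ {p} → q * q ∣ c ∸ p → p ≤ b → p ∣ progression r (q * q) N
    p∣ {p} q²∣ p≤b = subst (_∣ progression r (q * q) N)
      (sym (trans (m≡m%n+[m/n]*n p (q * q)) (cong (_+ p / (q * q) * (q * q)) (trans (residue q²∣ p≤b) c%≡r))))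
      (term-∣-progression r (q * q) (*-cancelʳ-< (q * q) (p / (q * q)) N (≤-<-trans (m/n*n≤m p (q * q)) (≤-<-trans p≤b b<Nq²))))

-- Charging pairs of primes to squares

∏ : List ℕ → (ℕ → ℕ) → ℕ
∏ xs f = product (map f xs)

∏-mono-≤ : ∀ {f g} xs → (∀ {x} → x ∈ xs → f x ≤ g x) → ∏ xs f ≤ ∏ xs g
∏-mono-≤ []       f≤g = ≤-refl
∏-mono-≤ (x ∷ xs) f≤g = *-mono-≤ (f≤g (here refl)) (∏-mono-≤ xs (f≤g ∘ there))

∏-bound : ∀ {f c} xs → (∀ {x} → x ∈ xs → f x ≤ c) → ∏ xs f ≤ c ^ length xs
∏-bound []       f≤c = ≤-refl
∏-bound (x ∷ xs) f≤c = *-mono-≤ (f≤c (here refl)) (∏-bound xs (f≤c ∘ there))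

∏-1 : ∀ xs → ∏ xs (λ _ → 1) ≡ 1
∏-1 []       = refl
∏-1 (x ∷ xs) = trans (*-identityˡ _) (∏-1 xs)

∏-* : ∀ f g xs → ∏ xs (λ x → f x * g x) ≡ ∏ xs f * ∏ xs g
∏-* f g []       = refl
∏-* f g (x ∷ xs) = trans (cong (f x * g x *_) (∏-* f g xs)) (interchange (f x) (g x) (∏ xs f) (∏ xs g))
  where
  interchange : ∀ a b c d → a * b * (c * d) ≡ a * c * (b * d)
  interchange = solve-∀

∏-swap : ∀ (f : ℕ → ℕ → ℕ) xs ys → ∏ xs (λ x → ∏ ys (f x)) ≡ ∏ ys (λ y → ∏ xs (λ x → f x y))
∏-swap f []       ys = sym (∏-1 ys)
∏-swap f (x ∷ xs) ys = trans (cong (∏ ys (f x) *_) (∏-swap f xs ys))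
  (sym (∏-* (f x) (λ y → ∏ xs (λ x → f x y)) ys))

∏-^ : ∀ k xs → ∏ xs (_^ k) ≡ product xs ^ k
∏-^ k []       = sym (^-zeroˡ k)
∏-^ k (x ∷ xs) = trans (cong (x ^ k *_) (∏-^ k xs)) (sym (^-distribʳ-* k x (product xs)))

∏-const : ∀ c xs → ∏ xs (λ _ → c) ≡ c ^ length xs
∏-const c []       = refl
∏-const c (x ∷ xs) = cong (c *_) (∏-const c xs)

∏-++ : ∀ f xs ys → ∏ (xs ++ ys) f ≡ ∏ xs f * ∏ ys f
∏-++ f xs ys = trans (cong product (map-++ f xs ys)) (product-++ (map f xs) (map f ys))

∏-^-sum : ∀ w f xs → ∏ xs (λ x → w ^ f x) ≡ w ^ sum (map f xs)
∏-^-sum w f []       = refl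
∏-^-sum w f (x ∷ xs) = trans (cong (w ^ f x *_) (∏-^-sum w f xs)) (sym (^-distribˡ-+-* w (f x) _))

-- Charges are multiplied, with 1 for no charge, so that the weights log r of the usual argument
-- become the integers r.
charge : ℕ → ℕ → ℕ → ℕ
charge w m q = if does (q * q ∣? m) then w else 1

charge-∣ : ∀ w m q → q * q ∣ m → charge w m q ≡ w
charge-∣ w m q q²∣m with q * q ∣? m
... | yes _    = refl
... | no q²∤m = contradiction q²∣m q²∤m

1≤charge : ∀ {w} → 1 ≤ w → ∀ m q → 1 ≤ charge w m q
1≤charge 1≤w m q with q * q ∣? m
... | yes _ = 1≤w
... | no  _ = ≤-refl

1≤∏charge : ∀ {w} → 1 ≤ w → ∀ m qs → 1 ≤ ∏ qs (charge w m)
1≤∏charge 1≤w m []       = ≤-refl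
1≤∏charge 1≤w m (q ∷ qs) = *-mono-≤ (1≤charge 1≤w m q) (1≤∏charge 1≤w m qs)

Covers : List ℕ → ℕ → Set
Covers qs m = Any (λ q → q * q ∣ m) qs

covers⇒≤∏charge : ∀ {w qs m} → 1 ≤ w → Covers qs m → w ≤ ∏ qs (charge w m)
covers⇒≤∏charge {w} {q ∷ qs} {m} 1≤w (here q²∣m) = begin
  w                              ≡⟨ *-identityʳ w ⟨
  w * 1                          ≤⟨ *-mono-≤ (≤-reflexive (sym (charge-∣ w m q q²∣m))) (1≤∏charge 1≤w m qs) ⟩
  ∏ (q ∷ qs) (charge w m)        ∎
  where open ≤-Reasoning
covers⇒≤∏charge {w} {q ∷ qs} {m} 1≤w (there cov) = begin
  w                              ≡⟨ *-identityˡ w ⟨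
  1 * w                          ≤⟨ *-mono-≤ (1≤charge 1≤w m q) (covers⇒≤∏charge 1≤w cov) ⟩
  ∏ (q ∷ qs) (charge w m)        ∎
  where open ≤-Reasoning

∏-charge-const : ∀ w q (f : ℕ → ℕ) xs →
  ∏ xs (λ x → charge w (f x) q) ≡ w ^ length (filter (λ x → q * q ∣? f x) xs)
∏-charge-const w q f []       = refl
∏-charge-const w q f (x ∷ xs) with q * q ∣? f x
... | yes _ = cong (w *_) (∏-charge-const w q f xs)
... | no  _ = trans (*-identityˡ _) (∏-charge-const w q f xs)

∏-charge-self : ∀ q (f : ℕ → ℕ) xs →
  ∏ xs (λ x → charge x (f x) q) ≡ product (filter (λ x → q * q ∣? f x) xs)
∏-charge-self q f []       = refl
∏-charge-self q f (x ∷ xs) with q * q ∣? f x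
... | yes _ = cong (x *_) (∏-charge-self q f xs)
... | no  _ = trans (*-identityˡ _) (∏-charge-self q f xs)

-- μ q bounds the number of members of ps in a single residue class modulo q².
record Equidistributed (ps qs : List ℕ) (μ : ℕ → ℕ) (b : ℕ) : Set where
  field
    class-≤ : ∀ {q} → q ∈ qs → ∀ {c} → b ≤ c → length (filter (λ p → q * q ∣? (c ∸ p)) ps) ≤ μ q

-- Exchanging the products fixes q, which is then charged by at most μ q of the p.
∏∏charge-≤ : ∀ {ps qs μ b} → Equidistributed ps qs μ b → ∀ {w c} → 1 ≤ w → b ≤ c →
             ∏ ps (λ p → ∏ qs (charge w (c ∸ p))) ≤ w ^ sum (map μ qs)
∏∏charge-≤ {ps} {qs} {μ} equi {w} {c} 1≤w b≤c = begin
  ∏ ps (λ p → ∏ qs (charge w (c ∸ p)))            ≡⟨ ∏-swap (λ p q → charge w (c ∸ p) q) ps qs ⟩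
  ∏ qs (λ q → ∏ ps (λ p → charge w (c ∸ p) q))    ≤⟨ ∏-mono-≤ qs (λ {q} q∈ → ≤-trans (≤-reflexive (∏-charge-const w q (c ∸_) ps)) (^-monoʳ-≤ w {{>-nonZero 1≤w}} (Equidistributed.class-≤ equi q∈ b≤c))) ⟩
  ∏ qs (λ q → w ^ μ q)                            ≡⟨ ∏-^-sum w μ qs ⟩
  w ^ sum (map μ qs)                              ∎
  where open ≤-Reasoning

-- With the constant weight 2, comparing exponents turns the bound on charges into a plain count.
covered-list : ∀ {ps qs μ b} → Equidistributed ps qs μ b → ∀ {c} → b ≤ c →
               (∀ {p} → p ∈ ps → Covers qs (c ∸ p)) → length ps ≤ sum (map μ qs)
covered-list {ps} {qs} {μ} equi {c} b≤c cov = 2^-cancel-≤ (begin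
  2 ^ length ps                          ≡⟨ ∏-const 2 ps ⟨
  ∏ ps (λ _ → 2)                         ≤⟨ ∏-mono-≤ ps (λ p∈ → covers⇒≤∏charge (s≤s z≤n) (cov p∈)) ⟩
  ∏ ps (λ p → ∏ qs (charge 2 (c ∸ p)))   ≤⟨ ∏∏charge-≤ equi (s≤s z≤n) b≤c ⟩
  2 ^ sum (map μ qs)                     ∎)
  where open ≤-Reasoning

∸-swap : ∀ n p r → n ∸ p ∸ r ≡ n ∸ r ∸ p
∸-swap n p r = trans (∸-+-assoc n p r) (trans (cong (n ∸_) (+-comm p r)) (sym (∸-+-assoc n r p)))

-- Every pair charges r to some q in `qs` or `qs′`. Charges to `qs` are bounded for fixed r, by
-- counting p in residue classes with c = n - r; charges to `qs′` are bounded for fixed p, by B.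
covered-pairs : ∀ {ps qs μ b} → Equidistributed ps qs μ b → ∀ {rs qs′ n B} →
  (∀ {r} → r ∈ rs → 1 ≤ r × b ≤ n ∸ r) →
  (∀ {p r} → p ∈ ps → r ∈ rs → Covers qs (n ∸ p ∸ r) ⊎ Covers qs′ (n ∸ p ∸ r)) →
  (∀ {p} → p ∈ ps → ∏ qs′ (λ q → ∏ rs (λ r → charge r (n ∸ p ∸ r) q)) ≤ B) →
  product rs ^ length ps ≤ product rs ^ sum (map μ qs) * B ^ length ps
covered-pairs {ps} {qs} {μ} equi {rs} {qs′} {n} {B} rs-ok cov big = begin
  product rs ^ length ps                                    ≡⟨ ∏-const (product rs) ps ⟨
  ∏ ps (λ _ → product rs)                                   ≤⟨ ∏-mono-≤ ps per-p ⟩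
  ∏ ps (λ p → ∏ rs (S p) * ∏ rs (L p))                      ≡⟨ ∏-* (λ p → ∏ rs (S p)) (λ p → ∏ rs (L p)) ps ⟩
  ∏ ps (λ p → ∏ rs (S p)) * ∏ ps (λ p → ∏ rs (L p))         ≤⟨ *-mono-≤ small large ⟩
  product rs ^ sum (map μ qs) * B ^ length ps               ∎
  where
  open ≤-Reasoning
  S L : ℕ → ℕ → ℕ
  S p r = ∏ qs  (charge r (n ∸ p ∸ r))
  L p r = ∏ qs′ (charge r (n ∸ p ∸ r))
  r≤S*L : ∀ {p r} → p ∈ ps → r ∈ rs → r ≤ S p r * L p r
  r≤S*L {p} {r} p∈ r∈ with proj₁ (rs-ok r∈) | cov p∈ r∈
  ... | 1≤r | inj₁ c = ≤-trans (covers⇒≤∏charge 1≤r c) (m≤m*n (S p r) (L p r) {{>-nonZero (1≤∏charge 1≤r _ qs′)}})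
  ... | 1≤r | inj₂ c = ≤-trans (covers⇒≤∏charge 1≤r c) (m≤n*m (L p r) (S p r) {{>-nonZero (1≤∏charge 1≤r _ qs)}})
  per-p : ∀ {p} → p ∈ ps → product rs ≤ ∏ rs (S p) * ∏ rs (L p)
  per-p {p} p∈ = begin
    product rs                    ≡⟨ cong product (map-id rs) ⟨
    ∏ rs id                       ≤⟨ ∏-mono-≤ rs (r≤S*L p∈) ⟩
    ∏ rs (λ r → S p r * L p r)    ≡⟨ ∏-* (S p) (L p) rs ⟩
    ∏ rs (S p) * ∏ rs (L p)       ∎
  small : ∏ ps (λ p → ∏ rs (S p)) ≤ product rs ^ sum (map μ qs)
  small = begin
    ∏ ps (λ p → ∏ rs (S p))              ≡⟨ ∏-swap S ps rs ⟩
    ∏ rs (λ r → ∏ ps (λ p → S p r))      ≤⟨ ∏-mono-≤ rs column ⟩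
    ∏ rs (_^ sum (map μ qs))             ≡⟨ ∏-^ (sum (map μ qs)) rs ⟩
    product rs ^ sum (map μ qs)          ∎
    where
    column : ∀ {r} → r ∈ rs → ∏ ps (λ p → S p r) ≤ r ^ sum (map μ qs)
    column {r} r∈ = ≤-trans
      (∏-mono-≤ ps λ {p} _ → ≤-reflexive (cong (λ m → ∏ qs (charge r m)) (∸-swap n p r)))
      (∏∏charge-≤ equi (proj₁ (rs-ok r∈)) (proj₂ (rs-ok r∈)))
  large : ∏ ps (λ p → ∏ rs (L p)) ≤ B ^ length ps
  large = ∏-bound ps λ {p} p∈ → ≤-trans
    (≤-reflexive (∏-swap (λ r q → charge r (n ∸ p ∸ r) q) rs qs′)) (big p∈)

-- Dyadic blocks of large q.

dyadicPrimes : ℕ → ℕ → List ℕ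
dyadicPrimes i zero    = primes (2 ^ i) (2 ^ suc i)
dyadicPrimes i (suc l) = primes (2 ^ i) (2 ^ suc i) ++ dyadicPrimes (suc i) l

∈-dyadicPrimes⁺ : ∀ i l {q} → Prime q → 2 ^ i < q → q ≤ 2 ^ suc (i + l) → q ∈ dyadicPrimes i l
∈-dyadicPrimes⁺ i zero    {q} q-prime <q q≤ = ∈-primes⁺ q-prime <q (subst (λ j → q ≤ 2 ^ suc j) (+-identityʳ i) q≤)
∈-dyadicPrimes⁺ i (suc l) {q} q-prime <q q≤ with q ≤? 2 ^ suc i
... | yes q≤′ = ∈-++⁺ˡ (∈-primes⁺ q-prime <q q≤′)
... | no  q≰′ = ∈-++⁺ʳ (primes (2 ^ i) (2 ^ suc i))
  (∈-dyadicPrimes⁺ (suc i) l q-prime (≰⇒> q≰′) (subst (λ j → q ≤ 2 ^ suc j) (+-suc i l) q≤))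

module _ {a b c : ℕ} (b<c : b < c) where

  private
    column : ℕ → ℕ
    column q = ∏ (primes a b) (λ p → charge p (c ∸ p) q)

  -- The block has at most 2^i members q. Each has q² > 4^i, so 4^l terms of a progression modulo q²
  -- reach beyond b, and q³ is at most 2^(3(i + 1)).
  dyadic-block-≤ : ∀ i l → 4 ^ l ≤ a → b ≡ 4 ^ l * (2 ^ i * 2 ^ i) →
                   ∏ (primes (2 ^ i) (2 ^ suc i)) column ≤ 2 ^ (3 * suc i * 4 ^ l * 2 ^ i)
  dyadic-block-≤ i l 4^l≤a b≡ = begin
    ∏ qs column                                 ≤⟨ ∏-bound qs column-≤ ⟩
    (2 ^ (3 * suc i * 4 ^ l)) ^ length qs       ≤⟨ ^-monoʳ-≤ (2 ^ (3 * suc i * 4 ^ l)) {{m^n≢0 2 (3 * suc i * 4 ^ l)}} length≤ ⟩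
    (2 ^ (3 * suc i * 4 ^ l)) ^ (2 ^ i)         ≡⟨ ^-*-assoc 2 (3 * suc i * 4 ^ l) (2 ^ i) ⟩
    2 ^ (3 * suc i * 4 ^ l * 2 ^ i)             ∎
    where
    open ≤-Reasoning
    qs = primes (2 ^ i) (2 ^ suc i)
    length≤ : length qs ≤ 2 ^ i
    length≤ = ≤-trans (length-primes-≤ (2 ^ i) (2 ^ suc i))
      (≤-reflexive (trans (m+n∸m≡n (2 ^ i) (1 * 2 ^ i)) (*-identityˡ (2 ^ i))))
    column-≤ : ∀ {q} → q ∈ qs → column q ≤ 2 ^ (3 * suc i * 4 ^ l)
    column-≤ {q} q∈ with ∈-primes⁻ q∈
    ... | q-prime , 2^i<q , q≤2^1+i = begin
      column q                                                        ≡⟨ ∏-charge-self q (c ∸_) (primes a b) ⟩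
      product (filter (λ p → q * q ∣? (c ∸ p)) (primes a b))          ≤⟨ product-primes-with-q²∣-≤ q-prime b<c 4^l≤a b<4^l*q² ⟩
      (q * q * q) ^ (4 ^ l)                                           ≤⟨ ^-monoˡ-≤ (4 ^ l) (*-mono-≤ (*-mono-≤ q≤2^1+i q≤2^1+i) q≤2^1+i) ⟩
      (2 ^ suc i * 2 ^ suc i * 2 ^ suc i) ^ (4 ^ l)                   ≡⟨ cong (_^ (4 ^ l)) cube ⟩
      (2 ^ (3 * suc i)) ^ (4 ^ l)                                     ≡⟨ ^-*-assoc 2 (3 * suc i) (4 ^ l) ⟩
      2 ^ (3 * suc i * 4 ^ l)                                         ∎
      where
      b<4^l*q² : b < 4 ^ l * (q * q)
      b<4^l*q² = subst (_< 4 ^ l * (q * q)) (sym b≡)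
        (*-monoʳ-< (4 ^ l) {{m^n≢0 4 l}} (*-mono-< 2^i<q 2^i<q))
      cube : 2 ^ suc i * 2 ^ suc i * 2 ^ suc i ≡ 2 ^ (3 * suc i)
      cube = trans (power (2 ^ suc i)) (trans (^-*-assoc 2 (suc i) 3) (cong (2 ^_) (*-comm (suc i) 3)))
        where
        power : ∀ x → x * x * x ≡ x * (x * (x * 1))
        power = solve-∀

  -- From one block to the next, 2^i 4^l is halved. The factor 6(i + 2) is the sum of the series of
  -- 3(i + 1 + j)/2^j over all j ≥ 0, so the induction step is an identity.
  dyadic-tail-≤ : ∀ i l → 4 ^ l ≤ a → b ≡ 4 ^ l * (2 ^ i * 2 ^ i) →
                  ∏ (dyadicPrimes i l) column ≤ 2 ^ (6 * (2 + i) * (2 ^ i * 4 ^ l))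
  dyadic-tail-≤ i zero    4^l≤a b≡ = ≤-trans (dyadic-block-≤ i zero 4^l≤a b≡) (^-monoʳ-≤ 2 (begin
    3 * suc i * 1 * 2 ^ i          ≤⟨ m≤m+n _ ((3 * i + 9) * 2 ^ i) ⟩
    3 * suc i * 1 * 2 ^ i + (3 * i + 9) * 2 ^ i  ≡⟨ total i (2 ^ i) ⟩
    6 * (2 + i) * (2 ^ i * 1)      ∎))
    where
    open ≤-Reasoning
    total : ∀ i x → 3 * suc i * 1 * x + (3 * i + 9) * x ≡ 6 * (2 + i) * (x * 1)
    total = solve-∀
  dyadic-tail-≤ i (suc l) 4^l≤a b≡ = begin
    ∏ (qs ++ dyadicPrimes (suc i) l) column              ≡⟨ ∏-++ column qs (dyadicPrimes (suc i) l) ⟩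
    ∏ qs column * ∏ (dyadicPrimes (suc i) l) column      ≤⟨ *-mono-≤ (dyadic-block-≤ i (suc l) 4^l≤a b≡)
                                                              (dyadic-tail-≤ (suc i) l (≤-trans (m≤n*m (4 ^ l) 4) 4^l≤a)
                                                                (trans b≡ (regroup (4 ^ l) (2 ^ i)))) ⟩
    2 ^ x * 2 ^ y                                        ≡⟨ ^-distribˡ-+-* 2 x y ⟨
    2 ^ (x + y)                                          ≡⟨ cong (2 ^_) (total i (2 ^ i) (4 ^ l)) ⟩
    2 ^ (6 * (2 + i) * (2 ^ i * 4 ^ suc l))              ∎
    where
    open ≤-Reasoning
    qs = primes (2 ^ i) (2 ^ suc i)
    x = 3 * suc i * 4 ^ suc l * 2 ^ i
    y = 6 * (2 + suc i) * (2 ^ suc i * 4 ^ l)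
    regroup : ∀ x y → 4 * x * (y * y) ≡ x * (2 * y * (2 * y))
    regroup = solve-∀
    total : ∀ i x y → 3 * suc i * (4 * y) * x + 6 * (2 + suc i) * (2 * x * y) ≡ 6 * (2 + i) * (x * (4 * y))
    total = solve-∀

-- The distribution of the small primes

-- Trial division by d, d + 1, ... with fuel f. Exhausted fuel counts as success: primes pass with
-- any fuel, while soundness asks for n < (f + d)^2.
trial : ℕ → ℕ → ℕ → Bool
trial zero    d n = true
trial (suc f) d n = (n <ᵇ d * d) ∨ not (does (d ∣? n)) ∧ trial f (suc d) n

trial-sound : ∀ f d {n} → .{{NonTrivial n}} → d Rough n → n < (f + d) * (f + d) →
              T (trial f d n) → Prime n
trial-sound zero    d rough n< _ = rough∧square>⇒prime rough n<
trial-sound (suc f) d {n} rough n< t with n <ᵇ d * d in n<d²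
... | true  = rough∧square>⇒prime rough (<ᵇ⇒< n (d * d) (subst T (sym n<d²) tt))
... | false with d ∣? n
...   | no d∤n = trial-sound f (suc d) (∤⇒rough-suc d∤n rough)
                   (subst (λ s → n < s * s) (sym (+-suc f d)) n<) t

trial-complete : ∀ f {d n} → 2 ≤ d → Prime n → T (trial f d n)
trial-complete zero    2≤d n-prime = tt
trial-complete (suc f) {d} {n} 2≤d n-prime with n <ᵇ d * d in n≮d²
... | true  = tt
... | false with d ∣? n
...   | no  _   = trial-complete f (m≤n⇒m≤1+n 2≤d) n-prime
...   | yes d∣n = contradiction n-prime (composite⇒¬prime (hasNonTrivialDivisor {{n>1⇒nonTrivial 2≤d}} d<n d∣n))
  where
  d<n : d < n
  d<n = <-≤-trans (m<m*n d d {{>-nonZero (≤-trans (s≤s z≤n) 2≤d)}} 2≤d) (≮⇒≥ λ n<d² → subst T n≮d² (<⇒<ᵇ n<d²))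

-- Fuel 130 from the divisor 2 on decides primality below 132^2. The Boolean test keeps the lists
-- cheap to evaluate.
sieve : ℕ → List ℕ
sieve N = filter (λ n → T? ((1 <ᵇ n) ∧ trial 130 2 n)) (downFrom (suc N))

∈-sieve⁺ : ∀ {N} → Prime p → p ≤ N → p ∈ sieve N
∈-sieve⁺ {p} p-prime p≤N = ∈-filter⁺ (λ n → T? ((1 <ᵇ n) ∧ trial 130 2 n)) (∈-downFrom⁺ (s≤s p≤N)) passes
  where
  passes : T ((1 <ᵇ p) ∧ trial 130 2 p)
  passes with 1 <ᵇ p in 1≮p
  ... | true  = trial-complete 130 ≤-refl p-prime
  ... | false = subst T 1≮p (<⇒<ᵇ (prime⇒2≤ p-prime))

∈-sieve⁻ : ∀ {N} → N < 132 * 132 → p ∈ sieve N → Prime p × p ≤ N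
∈-sieve⁻ {p} {N} N< p∈ with ∈-filter⁻ (λ n → T? ((1 <ᵇ n) ∧ trial 130 2 n)) {xs = downFrom (suc N)} p∈
... | p∈range , passes = sound passes , s≤s⁻¹ (∈-downFrom⁻ p∈range)
  where
  sound : T ((1 <ᵇ p) ∧ trial 130 2 p) → Prime p
  sound t with 1 <ᵇ p in 1<p
  ... | true = trial-sound 130 2 {{n>1⇒nonTrivial (<ᵇ⇒< 1 p (subst T (sym 1<p) tt))}} 2-rough (≤-<-trans (s≤s⁻¹ (∈-downFrom⁻ p∈range)) N<) t

sieve-unique : ∀ N → Unique (sieve N)
sieve-unique N = Unique.filter⁺ (λ n → T? ((1 <ᵇ n) ∧ trial 130 2 n)) (Unique.downFrom⁺ (suc N))

module _ {P Q : Pred ℕ 0ℓ} (P? : Decidable P) (Q? : Decidable Q) where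

  length-filter-map-≤ : ∀ f xs → (∀ {x} → x ∈ xs → P x → Q (f x)) →
                        length (filter P? xs) ≤ length (filter Q? (map f xs))
  length-filter-map-≤ f []       P⇒Q = z≤n
  length-filter-map-≤ f (x ∷ xs) P⇒Q with P? x | Q? (f x)
  ... | yes _  | yes _  = s≤s (length-filter-map-≤ f xs (P⇒Q ∘ there))
  ... | yes Px | no ¬Q  = contradiction (P⇒Q (here refl) Px) ¬Q
  ... | no  _  | yes _  = m≤n⇒m≤1+n (length-filter-map-≤ f xs (P⇒Q ∘ there))
  ... | no  _  | no  _  = length-filter-map-≤ f xs (P⇒Q ∘ there)

  length-filter-filter-≤ : ∀ xs → (∀ {x} → P x → Q x) →
                           length (filter P? xs) ≤ length (filter P? (filter Q? xs))
  length-filter-filter-≤ []       P⇒Q = z≤n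
  length-filter-filter-≤ (x ∷ xs) P⇒Q with Q? x
  ... | no ¬Q with P? x
  ...   | yes Px = contradiction (P⇒Q Px) ¬Q
  ...   | no  _  = length-filter-filter-≤ xs P⇒Q
  length-filter-filter-≤ (x ∷ xs) P⇒Q | yes _ with P? x
  ...   | yes _ = s≤s (length-filter-filter-≤ xs P⇒Q)
  ...   | no  _ = length-filter-filter-≤ xs P⇒Q

-- Sorts by the k lowest binary digits, so it is the largest multiplicity of an element
-- when all elements are below 2^k, and an upper bound for it in any case.
maxCount : ℕ → List ℕ → ℕ
maxCount _       []         = 0
maxCount zero    xs@(_ ∷ _) = length xs
maxCount (suc k) xs@(_ ∷ _) =
  maxCount k (map (_/ 2) (filter (λ x → x % 2 ≟ 0) xs)) ⊔
  maxCount k (map (_/ 2) (filter (λ x → x % 2 ≟ 1) xs))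

count-≤-maxCount : ∀ k xs r → length (filter (_≟ r) xs) ≤ maxCount k xs
count-≤-maxCount k       []           r = z≤n
count-≤-maxCount zero    xs@(_ ∷ _)   r = length-filter (_≟ r) xs
count-≤-maxCount (suc k) xs@(_ ∷ _) r = bound (r % 2) refl (m%n<n r 2)
  where
  class : ℕ → List ℕ
  class s = filter (λ x → x % 2 ≟ s) xs
  half : ∀ s → r % 2 ≡ s → length (filter (_≟ r) xs) ≤ maxCount k (map (_/ 2) (class s))
  half s r%2≡s = ≤-trans (length-filter-filter-≤ (_≟ r) (λ x → x % 2 ≟ s) xs λ x≡r → trans (cong (_% 2) x≡r) r%2≡s)
    (≤-trans (length-filter-map-≤ (_≟ r) (_≟ r / 2) (_/ 2) (class s) λ _ → cong (_/ 2))
             (count-≤-maxCount k (map (_/ 2) (class s)) (r / 2)))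
  bound : ∀ s → r % 2 ≡ s → s < 2 → length (filter (_≟ r) xs) ≤ maxCount (suc k) xs
  bound 0 r%2≡0 _ = m≤n⇒m≤n⊔o (maxCount k (map (_/ 2) (class 1))) (half 0 r%2≡0)
  bound 1 r%2≡1 _ = m≤n⇒m≤o⊔n (maxCount k (map (_/ 2) (class 0))) (half 1 r%2≡1)
  bound (2+ _) _ (s≤s (s≤s ()))

-- If q² > b, numbers up to b are their own residues, so each class holds at most one of them.
-- Otherwise the residues are below q² ≤ b, and 15 binary digits separate them for b = 17389. At q =
-- 0 the trivial bound is taken.
multiplicity : ℕ → List ℕ → ℕ → ℕ
multiplicity b ps zero      = length ps
multiplicity b ps q@(suc _) = if b <ᵇ q * q then 1 else maxCount 15 (map (_% (q * q)) ps)

length-constant-≤ : ∀ {xs : List ℕ} {r} → Unique xs → (∀ {x} → x ∈ xs → x ≡ r) → length xs ≤ 1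
length-constant-≤ {[]}         _ _ = z≤n
length-constant-≤ {x ∷ []}     _ _ = ≤-refl
length-constant-≤ {x ∷ y ∷ xs} ((x≢y ∷ _) ∷ _) ≡r =
  contradiction (trans (≡r (here refl)) (sym (≡r (there (here refl))))) x≢y

equidistributed : ∀ {b} → Unique ps → (∀ {p} → p ∈ ps → p ≤ b) → ∀ qs →
                  Equidistributed ps qs (multiplicity b ps) b
equidistributed {ps} {b} u ps≤b qs = record { class-≤ = λ {q} _ b≤c → bound q b≤c }
  where
  bound : ∀ q {c} → b ≤ c → length (filter (λ p → q * q ∣? (c ∸ p)) ps) ≤ multiplicity b ps q
  bound zero      {c} b≤c = length-filter (λ p → 0 ∣? (c ∸ p)) ps
  bound q@(suc _) {c} b≤c with b <ᵇ q * q in b<q²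
  ... | true = length-constant-≤ (Unique.filter⁺ (λ p → q * q ∣? (c ∸ p)) u) λ {p} p∈ →
    let p∈ps , q²∣ = ∈-filter⁻ (λ p → q * q ∣? (c ∸ p)) {xs = ps} p∈ in
    trans (sym (m<n⇒m%n≡m (≤-<-trans (ps≤b p∈ps) (<ᵇ⇒< b (q * q) (subst T (sym b<q²) tt)))))
          (∣∸⇒%≡ (≤-trans (ps≤b p∈ps) b≤c) q²∣)
  ... | false = ≤-trans
    (length-filter-map-≤ (λ p → q * q ∣? (c ∸ p)) (_≟ c % (q * q)) (_% (q * q)) ps
      λ p∈ → ∣∸⇒%≡ (≤-trans (ps≤b p∈) b≤c))
    (count-≤-maxCount 15 (map (_% (q * q)) ps) (c % (q * q)))

-- Large n

Represented : ℕ → Set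
Represented n = ∃[ p₁ ] ∃[ p₂ ] ∃[ η ] (Prime p₁ × Prime p₂ × SquareFree η × n ≡ p₁ + p₂ + η)

represented : ∀ {n p r} → Prime p → Prime r → p + r ≤ n → SquareFree (n ∸ p ∸ r) → Represented n
represented {n} {p} {r} p-prime r-prime p+r≤n sf = p , r , n ∸ p ∸ r , p-prime , r-prime , sf ,
  sym (trans (cong (p + r +_) (∸-+-assoc n p r)) (m+[n∸m]≡n p+r≤n))

squareFree-or-covered : ∀ qs {m} → 0 < m → (∀ {q} → Prime q → q * q ≤ m → q ∈ qs) →
                        SquareFree m ⊎ Covers qs m
squareFree-or-covered qs {m} 0<m complete with any? (λ q → q * q ∣? m) qs
... | yes covers = inj₂ covers
... | no ¬covers = inj₁ record
  { positive = 0<m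
  ; p²∤n     = λ q q-prime q²∣m → ¬covers (cover q-prime q²∣m)
  }
  where
  cover : ∀ {q} → Prime q → q * q ∣ m → Covers qs m
  cover q-prime q²∣m = Any.map (λ { refl → q²∣m }) (complete q-prime (∣⇒≤ {{>-nonZero 0<m}} q²∣m))

-- The constructive form of assuming that no representation exists: either one is found, or the
-- obstruction is available for every x.
search : ∀ {A : Set} {B : ℕ → Set} xs → (∀ {x} → x ∈ xs → A ⊎ B x) → A ⊎ (∀ {x} → x ∈ xs → B x)
search []       f = inj₂ λ ()
search (x ∷ xs) f with f (here refl) | search xs (f ∘ there)
... | inj₁ a | _       = inj₁ a
... | inj₂ _ | inj₁ a  = inj₁ a
... | inj₂ b | inj₂ bs = inj₂ λ { (here refl) → b ; (there x∈) → bs x∈ }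

m²≤n²⇒m≤n : ∀ m n → m * m ≤ n * n → m ≤ n
m²≤n²⇒m≤n m n m²≤n² = ≮⇒≥ λ n<m → <⇒≱ (*-mono-< n<m n<m) m²≤n²

m²<n²⇒m<n : ∀ m n → m * m < n * n → m < n
m²<n²⇒m<n m n m²<n² = ≰⇒> λ n≤m → <⇒≱ m²<n² (*-mono-≤ n≤m n≤m)

0<n∸p∸r : ∀ {n p r} → p + r < n → 0 < n ∸ p ∸ r
0<n∸p∸r {n} {p} {r} p+r<n = subst (0 <_) (sym (∸-+-assoc n p r)) (m<n⇒0<n∸m p+r<n)

2^[m+n]²≡ : ∀ y x → 2 ^ (y + x) * 2 ^ (y + x) ≡ 4 ^ y * (2 ^ x * 2 ^ x)
2^[m+n]²≡ y x = begin
  2 ^ (y + x) * 2 ^ (y + x)          ≡⟨ cong₂ _*_ (^-distribˡ-+-* 2 y x) (^-distribˡ-+-* 2 y x) ⟩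
  2 ^ y * 2 ^ x * (2 ^ y * 2 ^ x)    ≡⟨ regroup (2 ^ y) (2 ^ x) ⟩
  2 ^ y * 2 ^ y * (2 ^ x * 2 ^ x)    ≡⟨ cong (_* (2 ^ x * 2 ^ x)) (trans (4^n≡2^[n+n] y) (^-distribˡ-+-* 2 y y)) ⟨
  4 ^ y * (2 ^ x * 2 ^ x)            ∎
  where
  open ≡-Reasoning
  regroup : ∀ a b → a * b * (a * b) ≡ a * a * (b * b)
  regroup = solve-∀

-- Cancelling W^M leaves W^D ≤ 2^(T (M + D)); this is set against the D-th power of the lower bound
-- for W. Here D is the number of p in excess of the total multiplicity M.
exponents-≤ : ∀ {W x E T} M D → 1 ≤ W → 2 ^ x ≤ 2 ^ E * W → W ^ (M + D) ≤ W ^ M * (2 ^ T) ^ (M + D) →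
              x * D ≤ E * D + T * (M + D)
exponents-≤ {W} {x} {E} {T} M D 1≤W lower upper = 2^-cancel-≤ (begin
  2 ^ (x * D)                          ≡⟨ ^-*-assoc 2 x D ⟨
  (2 ^ x) ^ D                          ≤⟨ ^-monoˡ-≤ D lower ⟩
  (2 ^ E * W) ^ D                      ≡⟨ ^-distribʳ-* D (2 ^ E) W ⟩
  (2 ^ E) ^ D * W ^ D                  ≤⟨ *-monoʳ-≤ ((2 ^ E) ^ D) W^D≤ ⟩
  (2 ^ E) ^ D * (2 ^ T) ^ (M + D)      ≡⟨ cong₂ _*_ (^-*-assoc 2 E D) (^-*-assoc 2 T (M + D)) ⟩
  2 ^ (E * D) * 2 ^ (T * (M + D))      ≡⟨ ^-distribˡ-+-* 2 (E * D) (T * (M + D)) ⟨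
  2 ^ (E * D + T * (M + D))            ∎)
  where
  open ≤-Reasoning
  instance
    W≢0 = >-nonZero 1≤W
    W^M≢0 = m^n≢0 W M
  W^D≤ : W ^ D ≤ (2 ^ T) ^ (M + D)
  W^D≤ = *-cancelˡ-≤ (W ^ M) (≤-trans (≤-reflexive (sym (^-distribˡ-+-* W M D))) upper)

-- Both sides are 44 at n = 2; afterwards the right side doubles while the left grows by 4.
4*[n+9]≤11*2^n : 2 ≤′ n → 4 * (n + 9) ≤ 11 * 2 ^ n
4*[n+9]≤11*2^n (≤′-reflexive refl) = ≤-refl
4*[n+9]≤11*2^n {suc n} (≤′-step 2≤n) = begin
  4 * (suc n + 9)            ≡⟨ expand n ⟩
  4 + 4 * (n + 9)            ≤⟨ +-mono-≤ (≤-trans (m≤m*n 4 (n + 9) {{>-nonZero (≤-trans (s≤s z≤n) (m≤n+m 9 n))}}) ih) ih ⟩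
  11 * 2 ^ n + 11 * 2 ^ n    ≡⟨ double (2 ^ n) ⟩
  11 * 2 ^ suc n             ∎
  where
  open ≤-Reasoning
  ih = 4*[n+9]≤11*2^n 2≤n
  expand : ∀ n → 4 * (suc n + 9) ≡ 4 + 4 * (n + 9)
  expand = solve-∀
  double : ∀ x → 11 * x + 11 * x ≡ 11 * (2 * x)
  double = solve-∀

-- In terms of the introduction, k = L + 9.
bound : ℕ → ℕ
bound L = 2 ^ (L + 9) * 2 ^ (L + 9)

-- In the hypothesis numeric, 2 ^ 18, 13825 and 66 * 2 ^ 9 are, in units of 4 ^ L, the exponents
-- of 2 in 2 ^ x, in the loss 2 ^ x / W, and in the charges to all q > 2 ^ 9 for a single p.
module Asymptotic
  {ps qs : List ℕ} {b M D : ℕ}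
  (ps-prime : ∀ {p} → p ∈ ps → Prime p) (ps-≤ : ∀ {p} → p ∈ ps → p ≤ b)
  (b≤2^16 : b ≤ 2 ^ 16)
  (qs-complete : ∀ {q} → Prime q → q ≤ 2 ^ 9 → q ∈ qs)
  (equi : Equidistributed ps qs (multiplicity b ps) b)
  (total : sum (map (multiplicity b ps) qs) ≡ M) (length-ps : length ps ≡ M + D)
  (numeric : 13825 * D + 66 * 2 ^ 9 * (M + D) < 2 ^ 18 * D)
  where

  module _ (L : ℕ) (2≤L : 2 ≤ L) {n : ℕ} (n> : bound L + b < n) (n≤ : n ≤ bound (suc L) + b) where

    private
      x = bound L
      -- Large enough for b ≤ a and 4^L ≤ a, yet only a 64th of x, so that dropping the primes up to
      -- a is affordable.
      a = 2 ^ (L + L + 12)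
      rs = primes a x
      W = product rs
      E = 2 + (2 ^ (L + 9) * (L + 9 + (L + 9)) + a) * 2
      -- This is the exponent in `dyadic-tail-≤` at i = 9 and l = L, with 66 = 6 (2 + 9).
      T′ = 66 * (2 ^ 9 * 4 ^ L)

    b≤a : b ≤ a
    b≤a = ≤-trans b≤2^16 (^-monoʳ-≤ 2 (+-monoˡ-≤ 12 (+-mono-≤ 2≤L 2≤L)))

    4^L≤a : 4 ^ L ≤ a
    4^L≤a = ≤-trans (≤-reflexive (4^n≡2^[n+n] L)) (^-monoʳ-≤ 2 (m≤m+n (L + L) 12))

    p+r<n : ∀ {p r} → p ∈ ps → r ∈ rs → p + r < n
    p+r<n {p} {r} p∈ r∈ = ≤-<-trans (≤-trans (+-mono-≤ (ps-≤ p∈) (proj₂ (proj₂ (∈-primes⁻ r∈)))) (≤-reflexive (+-comm b x))) n>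

    complete : ∀ {p r} → p ∈ ps → r ∈ rs → ∀ {q} → Prime q → q * q ≤ n ∸ p ∸ r → q ∈ qs ++ dyadicPrimes 9 L
    complete {p} {r} p∈ r∈ {q} q-prime q²≤ with q ≤? 2 ^ 9
    ... | yes q≤2^9 = ∈-++⁺ˡ (qs-complete q-prime q≤2^9)
    ... | no  q≰2^9 = ∈-++⁺ʳ qs (∈-dyadicPrimes⁺ 9 L q-prime (≰⇒> q≰2^9) (subst (λ j → q ≤ 2 ^ suc j) (+-comm L 9) (m²≤n²⇒m≤n q (2 ^ (suc L + 9)) (begin
      q * q                      ≤⟨ q²≤ ⟩
      n ∸ p ∸ r                  ≡⟨ ∸-swap n p r ⟩
      n ∸ r ∸ p                  ≤⟨ m∸n≤m (n ∸ r) p ⟩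
      -- As r > a ≥ b, subtracting r removes the b in the upper limit for n; thus q is at most 2^(L
      -- + 10), where the last dyadic block ends.
      n ∸ r                      ≤⟨ ∸-mono n≤ (≤-trans b≤a (<⇒≤ (proj₁ (proj₂ (∈-primes⁻ r∈))))) ⟩
      bound (suc L) + b ∸ b      ≡⟨ m+n∸n≡m (bound (suc L)) b ⟩
      bound (suc L)              ∎))))
      where
      open ≤-Reasoning

    case-split : ∀ {p r} → p ∈ ps → r ∈ rs →
                 Represented n ⊎ (Covers qs (n ∸ p ∸ r) ⊎ Covers (dyadicPrimes 9 L) (n ∸ p ∸ r))
    case-split {p} {r} p∈ r∈ with squareFree-or-covered (qs ++ dyadicPrimes 9 L) (0<n∸p∸r {n} {p} {r} (p+r<n p∈ r∈)) (complete p∈ r∈)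
    ... | inj₁ sf     = inj₁ (represented {n} {p} {r} (ps-prime p∈) (proj₁ (∈-primes⁻ r∈)) (<⇒≤ (p+r<n p∈ r∈)) sf)
    ... | inj₂ covers = inj₂ (++⁻ qs covers)

    -- The coefficient is 1 + 11 · 2^9 + 2^13: the constant 2 is at most 4^L, the term with L + 9 is
    -- absorbed by `4*[n+9]≤11*2^n`, and a enters twice.
    E≤ : E ≤ 13825 * 4 ^ L
    E≤ = begin
      E                                                ≡⟨ cong (λ z → 2 + (z * (L + 9 + (L + 9)) + a) * 2) (trans (^-distribˡ-+-* 2 L 9) (*-comm (2 ^ L) (2 ^ 9))) ⟩
      2 + (2 ^ 9 * 2 ^ L * (L + 9 + (L + 9)) + a) * 2  ≡⟨ cong (λ z → 2 + (2 ^ 9 * 2 ^ L * (L + 9 + (L + 9)) + z) * 2) a≡ ⟩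
      2 + (2 ^ 9 * 2 ^ L * (L + 9 + (L + 9)) + 2 ^ 12 * 4 ^ L) * 2  ≡⟨ regroup (2 ^ 9) (2 ^ L) (L + 9) (2 ^ 12) (4 ^ L) ⟩
      2 + (2 ^ 9 * (2 ^ L * (4 * (L + 9))) + 2 ^ 12 * 2 * 4 ^ L)    ≤⟨ +-mono-≤ {2} {4 ^ L} 2≤4^L (+-monoˡ-≤ (2 ^ 12 * 2 * 4 ^ L) (*-monoʳ-≤ (2 ^ 9) (*-monoʳ-≤ (2 ^ L) (4*[n+9]≤11*2^n (≤⇒≤′ 2≤L))))) ⟩
      4 ^ L + (2 ^ 9 * (2 ^ L * (11 * 2 ^ L)) + 2 ^ 12 * 2 * 4 ^ L) ≡⟨ cong (λ z → 4 ^ L + (z + 2 ^ 12 * 2 * 4 ^ L)) (trans (regroup₂ (2 ^ 9) (2 ^ L)) (cong (2 ^ 9 * 11 *_) (sym (trans (4^n≡2^[n+n] L) (^-distribˡ-+-* 2 L L))))) ⟩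
      4 ^ L + (2 ^ 9 * 11 * 4 ^ L + 2 ^ 12 * 2 * 4 ^ L)             ≡⟨ regroup₃ (2 ^ 9 * 11) (2 ^ 12 * 2) (4 ^ L) ⟩
      (1 + (2 ^ 9 * 11 + 2 ^ 12 * 2)) * 4 ^ L                       ∎
      where
      open ≤-Reasoning
      a≡ : a ≡ 2 ^ 12 * 4 ^ L
      a≡ = trans (^-distribˡ-+-* 2 (L + L) 12) (trans (*-comm (2 ^ (L + L)) (2 ^ 12)) (cong (2 ^ 12 *_) (sym (4^n≡2^[n+n] L))))
      2≤4^L : 2 ≤ 4 ^ L
      2≤4^L = ≤-trans (s≤s (s≤s z≤n)) (^-monoʳ-≤ 4 (<⇒≤ 2≤L))
      regroup : ∀ u v w s t → 2 + (u * v * (w + w) + s * t) * 2 ≡ 2 + (u * (v * (4 * w)) + s * 2 * t)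
      regroup = solve-∀
      regroup₂ : ∀ u v → u * (v * (11 * v)) ≡ u * 11 * (v * v)
      regroup₂ = solve-∀
      regroup₃ : ∀ u v w → w + (u * w + v * w) ≡ (1 + (u + v)) * w
      regroup₃ = solve-∀

    x≡ : x ≡ 4 ^ L * 2 ^ 18
    x≡ = 2^[m+n]²≡ L 9

    -- All exponents are bounded in units of 4^L, so one numerical inequality refutes the covering
    -- for every L.
    ¬all-covered : ¬ (∀ {p} → p ∈ ps → ∀ {r} → r ∈ rs →
                      Covers qs (n ∸ p ∸ r) ⊎ Covers (dyadicPrimes 9 L) (n ∸ p ∸ r))
    ¬all-covered cov = <⇒≱ numeric (*-cancelˡ-≤ (4 ^ L) {{m^n≢0 4 L}} (begin
      4 ^ L * (2 ^ 18 * D)                              ≡⟨ *-assoc (4 ^ L) (2 ^ 18) D ⟨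
      4 ^ L * 2 ^ 18 * D                                ≡⟨ cong (_* D) x≡ ⟨
      x * D                                             ≤⟨ exponents-≤ {W} {x} {E} {T′} M D (productOfPrimes≥1 (primes-prime a x)) (product-primes-≥ (L + 9) (L + L + 12) {{>-nonZero (≤-trans (s≤s z≤n) (m≤n+m 9 L))}}) upper ⟩
      E * D + T′ * (M + D)                              ≤⟨ +-monoˡ-≤ (T′ * (M + D)) (*-monoˡ-≤ D E≤) ⟩
      13825 * 4 ^ L * D + 66 * (2 ^ 9 * 4 ^ L) * (M + D)  ≡⟨ regroup 13825 66 (2 ^ 9) (4 ^ L) D (M + D) ⟩
      4 ^ L * (13825 * D + 66 * 2 ^ 9 * (M + D))        ∎))
      where
      open ≤-Reasoning
      regroup : ∀ c e f y D K → c * y * D + e * (f * y) * K ≡ y * (c * D + e * f * K)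
      regroup = solve-∀
      upper : W ^ (M + D) ≤ W ^ M * (2 ^ T′) ^ (M + D)
      upper = subst₂ (λ K S → W ^ K ≤ W ^ S * (2 ^ T′) ^ K) length-ps total
        (covered-pairs equi {rs} {dyadicPrimes 9 L} {n} {2 ^ T′}
          (λ r∈ → let r-prime , _ , r≤x = ∈-primes⁻ r∈ in
                  prime>0 r-prime , m+n≤o⇒m≤o∸n b (≤-trans (+-monoʳ-≤ b r≤x) (≤-trans (≤-reflexive (+-comm b x)) (<⇒≤ n>))))
          (λ p∈ r∈ → cov p∈ r∈)
          (λ {p} p∈ → dyadic-tail-≤ {a} {x} {n ∸ p} (m+n≤o⇒m≤o∸n (suc x) (≤-trans (s≤s (+-monoʳ-≤ x (ps-≤ p∈))) n>))
                        9 L 4^L≤a (2^[m+n]²≡ L 9)))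

    represented-between : Represented n
    represented-between with search ps (λ p∈ → search rs (λ r∈ → case-split p∈ r∈))
    ... | inj₁ rep = rep
    ... | inj₂ cov = ⊥-elim (¬all-covered λ p∈ r∈ → cov p∈ r∈)

-- Small and medium n

does≡true⇒ : ∀ {A : Set} (a? : Dec A) → does a? ≡ true → A
does≡true⇒ (yes a) refl = a

Direct : List ℕ → ℕ → ℕ → Set
Direct qs n p = 2 + p < n × ¬ Covers qs (n ∸ 2 ∸ p)

direct? : ∀ qs n p → Dec (Direct qs n p)
direct? qs n p = 2 + p <? n ×-dec ¬? (any? (λ q → q * q ∣? (n ∸ 2 ∸ p)) qs)

allDirect? : ∀ rs qs ns → Dec (All (λ n → Any (Direct qs n) rs) ns)
allDirect? rs qs = all? λ n → any? (direct? qs n) rs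

opaque
  range₅ : List ℕ
  range₅ = map (5 +_) (downFrom 17390)

  ∈-range₅⁺ : 4 < n → n ≤ 17394 → n ∈ range₅
  ∈-range₅⁺ n>4 n≤ = subst (_∈ map (5 +_) (downFrom 17390)) (m+[n∸m]≡n n>4)
    (∈-map⁺ (5 +_) (∈-downFrom⁺ (s≤s (∸-monoˡ-≤ 5 n≤))))

  -- By evaluation: for each n from 5 to 17394, the prime 2 and one of the eight primes up to 19
  -- leave a square-free rest. The primes up to 132 detect all squares, since 17394 < 133^2.
  allDirect : All (λ n → Any (Direct (sieve 132) n) (sieve 19)) range₅
  allDirect = does≡true⇒ (allDirect? (sieve 19) (sieve 132) range₅) refl

  smallPrimes : List ℕ
  smallPrimes = sieve 17389

  smallPrimes-unique : Unique smallPrimes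
  smallPrimes-unique = sieve-unique 17389

  ∈-smallPrimes⁻ : p ∈ smallPrimes → Prime p × p ≤ 17389
  ∈-smallPrimes⁻ = ∈-sieve⁻ (<ᵇ⇒< 17389 (132 * 132) tt)

  length-smallPrimes : length smallPrimes ≡ 2000
  length-smallPrimes = refl

  -- By evaluation. What counts is the gap to 2000: 300 here, for large n, and 88 for q up to 2052,
  -- for medium n.
  totalMultiplicity-512 : sum (map (multiplicity 17389 smallPrimes) (sieve 512)) ≡ 1700
  totalMultiplicity-512 = refl

  totalMultiplicity-2052 : sum (map (multiplicity 17389 smallPrimes) (sieve 2052)) ≡ 1912
  totalMultiplicity-2052 = refl

represented-small : n > 4 → n ≤ 17394 → Represented n
represented-small {n} n>4 n≤ with find (All.lookup allDirect (∈-range₅⁺ n>4 n≤))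
... | p , p∈ , 2+p<n , ¬covers =
  [ represented {n} {2} {p} prime[2] (proj₁ (∈-sieve⁻ {N = 19} (<ᵇ⇒< 19 (132 * 132) tt) p∈)) (<⇒≤ 2+p<n)
  , (λ covers → contradiction covers ¬covers) ]′
  (squareFree-or-covered (sieve 132) (0<n∸p∸r {n} {2} {p} 2+p<n)
    λ q-prime q²≤ → ∈-sieve⁺ q-prime (s≤s⁻¹ (m²<n²⇒m<n _ 133 (≤-<-trans q²≤ m<133²))))
  where
  m<133² : n ∸ 2 ∸ p < 133 * 133
  m<133² = ≤-<-trans (≤-trans (m∸n≤m (n ∸ 2) p) (≤-trans (m∸n≤m n 2) n≤)) (<ᵇ⇒< 17394 (133 * 133) tt)

equi : ∀ qs → Equidistributed smallPrimes qs (multiplicity 17389 smallPrimes) 17389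
equi = equidistributed smallPrimes-unique (proj₂ ∘ ∈-smallPrimes⁻)

-- Opaque, as its normal form is a unary numeral.
opaque
  4211693<2053² : 4211693 < 2053 * 2053
  4211693<2053² = <ᵇ⇒< 4211693 (2053 * 2053) tt

-- Take 2 and p from `smallPrimes`. Since n < 2053^2, only q up to 2052 can obstruct, and they
-- obstruct at most 1912 of the 2000 choices of p.
represented-medium : 17394 < n → n ≤ 4211693 → Represented n
represented-medium {n} n> n≤ with search smallPrimes cases
  where
  2+p<n : p ∈ smallPrimes → 2 + p < n
  2+p<n p∈ = ≤-<-trans (+-monoʳ-≤ 2 (proj₂ (∈-smallPrimes⁻ p∈))) (≤-<-trans (≤ᵇ⇒≤ 17391 17394 tt) n>)
  m<2053² : ∀ p → n ∸ 2 ∸ p < 2053 * 2053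
  m<2053² p = ≤-<-trans (≤-trans (m∸n≤m (n ∸ 2) p) (≤-trans (m∸n≤m n 2) n≤))
    4211693<2053²
  cases : p ∈ smallPrimes → Represented n ⊎ Covers (sieve 2052) (n ∸ 2 ∸ p)
  cases {p} p∈ = Sum.map₁ (represented {n} {2} {p} prime[2] (proj₁ (∈-smallPrimes⁻ p∈)) (<⇒≤ (2+p<n p∈)))
    (squareFree-or-covered (sieve 2052) (0<n∸p∸r {n} {2} {p} (2+p<n p∈))
      λ q-prime q²≤ → ∈-sieve⁺ q-prime (s≤s⁻¹ (m²<n²⇒m<n _ 2053 (≤-<-trans q²≤ (m<2053² p)))))
... | inj₁ rep    = rep
... | inj₂ covers = contradiction
  (subst₂ _≤_ length-smallPrimes totalMultiplicity-2052
    (covered-list (equi (sieve 2052)) (∸-monoˡ-≤ 2 (≤-trans (≤ᵇ⇒≤ 17391 17394 tt) (<⇒≤ n>))) covers))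
  (<⇒≱ (<ᵇ⇒< 1912 2000 tt))

locate : ∀ (f : ℕ → ℕ) d m → f m < n → n ≤ f (d + m) → ∃[ j ] (m ≤ j × f j < n × n ≤ f (suc j))
locate f zero    m fm<n n≤fm = contradiction n≤fm (<⇒≱ fm<n)
locate {n} f (suc d) m fm<n n≤ with n ≤? f (suc m)
... | yes n≤f = m , ≤-refl , fm<n , n≤f
... | no  n≰f =
  let j , m<j , fj<n , n≤fj = locate f d (suc m) (≰⇒> n≰f) (subst (λ i → n ≤ f i) (sym (+-suc d m)) n≤)
  in j , <⇒≤ m<j , fj<n , n≤fj

n≤2^n : ∀ n → n ≤ 2 ^ n
n≤2^n zero    = z≤n
n≤2^n (suc n) = +-mono-≤ (m^n>0 2 n) (≤-trans (n≤2^n n) (m≤m+n (2 ^ n) 0))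

n≤bound[n+2] : ∀ n → n ≤ bound (n + 2)
n≤bound[n+2] n = begin
  n                  ≤⟨ n≤2^n n ⟩
  2 ^ n              ≤⟨ ^-monoʳ-≤ 2 (≤-trans (m≤m+n n 2) (m≤m+n (n + 2) 9)) ⟩
  2 ^ (n + 2 + 9)    ≤⟨ m≤m*n (2 ^ (n + 2 + 9)) (2 ^ (n + 2 + 9)) {{m^n≢0 2 (n + 2 + 9)}} ⟩
  bound (n + 2)      ∎
  where open ≤-Reasoning

-- The medium range ends at 4^11 + 17389, exactly where the asymptotic argument starts with L = 2.
4211693≡ : 4211693 ≡ bound 2 + 17389
4211693≡ = refl

represented-large : 4211693 < n → Represented n
represented-large {n} n> with locate (λ L → bound L + 17389) n 2 (subst (_< n) 4211693≡ n>) (≤-trans (n≤bound[n+2] n) (m≤m+n (bound (n + 2)) 17389))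
... | L , 2≤L , n>bound , n≤bound = Asymptotic.represented-between
  {smallPrimes} {sieve 512} {17389} {1700} {300}
  (proj₁ ∘ ∈-smallPrimes⁻) (proj₂ ∘ ∈-smallPrimes⁻) (<⇒≤ (<ᵇ⇒< 17389 (2 ^ 16) tt))
  ∈-sieve⁺ (equi (sieve 512)) totalMultiplicity-512 length-smallPrimes
  -- The two sides are 71731500 and 78643200.
  (<ᵇ⇒< (13825 * 300 + 66 * 2 ^ 9 * (1700 + 300)) (2 ^ 18 * 300) tt)
  L 2≤L n>bound n≤bound

corollary2 : ∀ (n : ℕ) → n > 4 →
    ∃[ p₁ ] ∃[ p₂ ] ∃[ η ] (Prime p₁ × Prime p₂ × SquareFree η × n ≡ p₁ + p₂ + η)
corollary2 n n>4 with n ≤? 17394 | n ≤? 4211693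
... | yes n≤ | _      = represented-small n>4 n≤
... | no  n≰ | yes n≤ = represented-medium (≰⇒> n≰) n≤
... | no  n≰ | no  n≰′ = represented-large (≰⇒> n≰′)
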